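{- For primes $p<q$, the independence polynomial $$I(\varGamma(\mathbb{Z}_{p^2q}),x)=(1+x)^{(p-1)(p+q-1)}+(1+x)^{p(q-1)}-(1+x)^{(p-1)(q-1)}+(p-1)x(1+x)^{p(p-1)}$$ is log-concave and unimodal.
   Context: For a positive integer $n$, the zero divisor graph $\varGamma(\mathbb{Z}_n)$ is the simple undirected graph whose vertices are the non-zero zero divisors of the ring $\mathbb{Z}_n$ of integers modulo $n$ (non-zero $a$ such that $ab=0$ for some non-zero $b$), two distinct vertices $a,b$ being adjacent if and only if $ab=0$ in $\mathbb{Z}_n$. An independent set of a finite graph $G$ is a set of vertices no two of which are adjacent (the empty set included); $\alpha(G)$ is the maximum size of an independent set, and $s_k(G)$ is the number of independent sets of size $k$. The independence polynomial of $G$ is $I(G,x)=\sum_{k=0}^{\alpha(G)} s_k(G)x^k$. A polynomial $\sum_{i=0}^{n}\ell_i x^i$ (of degree $n$) is log-concave if $\ell_j^2\ge \ell_{j-1}\ell_{j+1}$ for all $1\le j\le n-1$; it is unimodal if there is an index $m$, $0\le m\le n$, with $\ell_0\le \ell_1\le\dots\le \ell_m\ge \ell_{m+1}\ge\dots\ge \ell_n$. -}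

module Defs where

open import Data.Fin using (Fin; toℕ)
open import Data.Fin.Properties as Fin using (all?; any?)
open import Data.Fin.Subset using (Subset; inside; outside; _∈_; ∣_∣)
open import Data.Fin.Subset.Properties using (_∈?_)
open import Data.Integer as ℤ using (ℤ; +_)
open import Data.List using (List; []; _∷_; [_]; _++_; map; filter; length; upTo)
open import Data.List.Extrema.Nat using (max)
open import Data.Nat as ℕ using (ℕ; zero; suc; NonZero; _<_)
open import Data.Nat.DivMod using (_mod_)
open import Data.Nat.Properties using (*-comm)
open import Data.Product using (∃-syntax; _×_; _,_)
import Data.Vec as Vec
open import Level using (0ℓ)
open import Relation.Binary using (Rel; Irreflexive; Symmetric)
import Relation.Binary as B
open import Relation.Binary.PropositionalEquality using (_≡_; _≢_; sym; trans; cong)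
open import Relation.Nullary using (¬_)
open import Relation.Nullary.Decidable using (¬?; _×-dec_; _→-dec_)
open import Relation.Unary using (Pred)
import Relation.Unary as U

-- The vertices form a decidable subset of Fin m, so that the non-zero zero
-- divisors need not be renumbered.  Only the restriction of Adj to vertices is
-- meaningful.
record SimpleGraph (m : ℕ) : Set₁ where
  field
    Vertex     : Pred (Fin m) 0ℓ
    Vertex?    : U.Decidable Vertex
    Adj        : Rel (Fin m) 0ℓ
    Adj?       : B.Decidable Adj
    Adj-sym    : Symmetric Adj
    Adj-irrefl : Irreflexive _≡_ Adj

module IntegersMod (n : ℕ) .{{_ : NonZero n}} where

  ℤₙ : Set
  ℤₙ = Fin n

  0ₙ : ℤₙ
  0ₙ = 0 mod n

  infixl 7 _*ₙ_
  _*ₙ_ : ℤₙ → ℤₙ → ℤₙ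
  a *ₙ b = (toℕ a ℕ.* toℕ b) mod n

  *ₙ-comm : ∀ a b → a *ₙ b ≡ b *ₙ a
  *ₙ-comm a b = cong (_mod n) (*-comm (toℕ a) (toℕ b))

  NonZeroZeroDivisor : Pred ℤₙ 0ℓ
  NonZeroZeroDivisor a = a ≢ 0ₙ × (∃[ b ] (b ≢ 0ₙ × a *ₙ b ≡ 0ₙ))

  nonZeroZeroDivisor? : U.Decidable NonZeroZeroDivisor
  nonZeroZeroDivisor? a =
    ¬? (a Fin.≟ 0ₙ) ×-dec any? λ b → ¬? (b Fin.≟ 0ₙ) ×-dec (a *ₙ b Fin.≟ 0ₙ)

zeroDivisorGraph : (n : ℕ) .{{_ : NonZero n}} → SimpleGraph n
zeroDivisorGraph n = record
  { Vertex     = NonZeroZeroDivisor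
  ; Vertex?    = nonZeroZeroDivisor?
  ; Adj        = λ a b → a ≢ b × a *ₙ b ≡ 0ₙ
  ; Adj?       = λ a b → ¬? (a Fin.≟ b) ×-dec (a *ₙ b Fin.≟ 0ₙ)
  ; Adj-sym    = λ {a} {b} (a≢b , ab≡0) →
                   (λ b≡a → a≢b (sym b≡a)) , trans (*ₙ-comm b a) ab≡0
  ; Adj-irrefl = λ a≡b (a≢b , _) → a≢b a≡b
  }
  where open IntegersMod n

allSubsets : (m : ℕ) → List (Subset m)
allSubsets zero    = [ Vec.[] ]
allSubsets (suc m) = map (outside Vec.∷_) (allSubsets m) ++ map (inside Vec.∷_) (allSubsets m)

-- Polynomials over ℤ in one variable, as lists of coefficients starting with
-- the constant one.  Trailing zeros are allowed, so equality of polynomials is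
-- _≈_ below, not _≡_.
Poly : Set
Poly = List ℤ

coeff : Poly → ℕ → ℤ
coeff []      _       = + 0
coeff (a ∷ f) zero    = a
coeff (a ∷ f) (suc k) = coeff f k

infix 4 _≈_
_≈_ : Poly → Poly → Set
f ≈ g = ∀ k → coeff f k ≡ coeff g k

const : ℤ → Poly
const a = [ a ]

X : Poly
X = + 0 ∷ + 1 ∷ []

infixl 6 _+_ _-_
infixl 7 _*_
infixr 8 _^_

_+_ : Poly → Poly → Poly
[]      + g       = g
(a ∷ f) + []      = a ∷ f
(a ∷ f) + (b ∷ g) = (a ℤ.+ b) ∷ (f + g)

_-_ : Poly → Poly → Poly
f - g = f + map ℤ.-_ g

_*_ : Poly → Poly → Poly
[]      * g = []
(a ∷ f) * g = map (a ℤ.*_) g + (+ 0 ∷ f * g)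

_^_ : Poly → ℕ → Poly
f ^ zero  = const (+ 1)
f ^ suc k = f * f ^ k

HasDegree : Poly → ℕ → Set
HasDegree f n = coeff f n ≢ + 0 × (∀ k → n < k → coeff f k ≡ + 0)

-- The index j below is shifted by one: suc j runs over 1, …, n − 1.
LogConcave : Poly → Set
LogConcave f = ∃[ n ] (HasDegree f n ×
  (∀ j → suc j < n →
     coeff f j ℤ.* coeff f (suc (suc j)) ℤ.≤ coeff f (suc j) ℤ.* coeff f (suc j)))

Unimodal : Poly → Set
Unimodal f = ∃[ n ] (HasDegree f n × (∃[ m ] (m ℕ.≤ n ×
  (∀ i → i < m → coeff f i ℤ.≤ coeff f (suc i)) ×
  (∀ i → m ℕ.≤ i → i < n → coeff f (suc i) ℤ.≤ coeff f i))))

module _ {m : ℕ} (G : SimpleGraph m) where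

  open SimpleGraph G

  Independent : Pred (Subset m) 0ℓ
  Independent S = (∀ a → a ∈ S → Vertex a) × (∀ a b → a ∈ S → b ∈ S → ¬ Adj a b)

  independent? : U.Decidable Independent
  independent? S =
    all? (λ a → (a ∈? S) →-dec Vertex? a) ×-dec
    all? (λ a → all? λ b → (a ∈? S) →-dec ((b ∈? S) →-dec ¬? (Adj? a b)))

  independentSets : List (Subset m)
  independentSets = filter independent? (allSubsets m)

  α : ℕ
  α = max 0 (map ∣_∣ independentSets)

  s : ℕ → ℕ
  s k = length (filter (λ S → ∣ S ∣ ℕ.≟ k) independentSets)

  independencePolynomial : Poly
  independencePolynomial = map (λ k → + s k) (upTo (suc α))

module Submission where

-- Sort the vertices by their greatest common divisor with p²q, and write a, b, c, d
-- for the numbers of those with divisor p, p², q, pq.  An independent set either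
-- avoids pq, and then consists of elements of the first class together with elements
-- of only one of the second and third, or it is one element of the fourth class
-- together with elements of the third.  Hence
--   I = (1 + x)^a ((1 + x)^b + (1 + x)^c - 1) + d x (1 + x)^c.
-- For p < q one has a = c + e with e ≥ 0, so that I = (1 + x)^c (g + d x) with
-- g = (1 + x)^e ((1 + x)^b + (1 + x)^c - 1).  Multiplication by 1 + x preserves
-- log-concavity of sequences without internal zeros, and (1 + x)^b + (1 + x)^c is such
-- a multiple of (1 + x)^n + 1.  Decreasing the constant coefficient by 1 does no harm,
-- and adding d x only endangers (g₁ + d) g₃ ≤ g₂², which is a polynomial inequality in
-- two parameters.

-- Sums of log-concave polynomials need not be log-concave, so the formula for I gives nothing by
-- itself. The factor (1 + x)^c is taken out because it shrinks the last summand to the monomial d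
-- x, which alters a single coefficient. The one inequality that this endangers does not follow from
-- log-concavity of g, since d has to be compared with actual coefficients; hence the explicit
-- values of g₁, g₂, g₃. Comparing only neighbouring coefficients would be too weak a notion: 1 +
-- x^3 passes that test, while (1 + x)(1 + x^3) = 1 + x + x^3 + x^4 fails it at x^2. The
-- inequalities are therefore required for all i ≤ j, and these also yield unimodality. Independent
-- sets are counted without bijections. A subset is scanned element by element, remembering only
-- which classes may still be added; few such states occur, and each has a closed formula proved by
-- Pascal's rule. The class sizes solve a linear system whose right-hand sides count multiples.
-- Everything is stated for natural numbers, with subtracted terms moved across the equation;
-- integers enter only for the final formula.

open import Data.Fin as Fin using (Fin; toℕ; fromℕ<)
import Data.Fin.Properties as Fin
open import Data.Fin.Subset using (Subset; inside; outside; _∈_)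
open import Data.List using (List; []; _∷_; _++_; map; filter; length; applyUpTo)
open import Data.List.Properties
  using (filter-++; filter-≐; filter-none; filter-some; length-++; length-map; map-upTo)
import Data.List.Relation.Unary.All as All
open import Data.Nat.Combinatorics using (_C_; nCk+nC[k+1]≡[n+1]C[k+1]; nC1≡n)
open import Data.Nat.Primality
  using (Prime; euclidsLemma; prime⇒nonZero; prime⇒nonTrivial; ¬prime[0]; ¬prime[1])
open import Data.Nat.Tactic.RingSolver using (solve-∀)
open import Data.Product using (_×_; _,_; proj₁; proj₂; ∃-syntax)
open import Data.Sum as Sum using (_⊎_; inj₁; inj₂; [_,_]′)
open import Function using (_∘_; id; _⇔_; mk⇔; Equivalence)
open import Relation.Binary.PropositionalEquality
open import Relation.Nullary using (¬_; Dec; yes; no; does; contradiction)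
open import Relation.Nullary.Decidable using (T?; dec-true; dec-false; does-⇔; _×-dec_)

module Combinatorics where

  open import Data.Bool using (Bool; true; false; T; _∧_; _∨_; not; if_then_else_)
  open import Data.Bool.Properties using (T-∧; ∨-comm; ∧-comm)
  open import Data.Fin.Subset using (∣_∣)
  open import Data.Nat
  open import Data.Nat.Properties
  open import Data.Unit using (tt)
  import Data.Vec as Vec
  open import Data.Vec using (here; there)
  open import Defs using (allSubsets)
  open import Level using (0ℓ)
  open import Relation.Unary using (Pred; Decidable)
  open import Algebra.Properties.CommutativeMonoid.Sum +-0-commutativeMonoid
    using (sum)
  open import Algebra.Properties.CommutativeSemigroup +-commutativeSemigroup
    using (interchange; xy∙z≈xz∙y)
  open import Algebra.Properties.CommutativeSemigroup *-commutativeSemigroup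
    using (x∙yz≈y∙xz)

  -- Coefficient sequences, multiplication by `1 + x`, and log-concavity.

  Seq : Set
  Seq = ℕ → ℕ

  shift : Seq → Seq
  shift f zero    = 0
  shift f (suc k) = f k

  [1+x]_ : Seq → Seq
  ([1+x] f) k = f k + shift f k

  [1+x]^ : ℕ → Seq → Seq
  [1+x]^ zero    f = f
  [1+x]^ (suc n) f = [1+x] ([1+x]^ n f)

  shift-cong : ∀ {f g} → f ≗ g → shift f ≗ shift g
  shift-cong f≗g zero    = refl
  shift-cong f≗g (suc k) = f≗g k

  shift-+ : ∀ f g → shift (λ k → f k + g k) ≗ λ k → shift f k + shift g k
  shift-+ f g zero    = refl
  shift-+ f g (suc k) = refl

  shift-* : ∀ d f → shift (λ k → d * f k) ≗ λ k → d * shift f k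
  shift-* d f zero    = sym (*-zeroʳ d)
  shift-* d f (suc k) = refl

  pascal : ∀ n → suc n C_ ≗ [1+x] (n C_)
  pascal n zero    = refl
  pascal n (suc k) = trans (sym (nCk+nC[k+1]≡[n+1]C[k+1] n k)) (+-comm (n C k) (n C suc k))

  [1+x]^-cong : ∀ n {f g} → f ≗ g → [1+x]^ n f ≗ [1+x]^ n g
  [1+x]^-cong zero    f≗g k = f≗g k
  [1+x]^-cong (suc n) f≗g k = cong₂ _+_ (ih k) (shift-cong ih k)
    where ih = [1+x]^-cong n f≗g

  [1+x]^-+ : ∀ n f g → [1+x]^ n (λ k → f k + g k) ≗ λ k → [1+x]^ n f k + [1+x]^ n g k
  [1+x]^-+ zero    f g k = refl
  [1+x]^-+ (suc n) f g k = trans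
    (cong₂ _+_ (ih k) (trans (shift-cong ih k) (shift-+ ([1+x]^ n f) ([1+x]^ n g) k)))
    (interchange ([1+x]^ n f k) ([1+x]^ n g k) (shift ([1+x]^ n f) k) (shift ([1+x]^ n g) k))
    where ih = [1+x]^-+ n f g

  [1+x]^-* : ∀ n d f → [1+x]^ n (λ k → d * f k) ≗ λ k → d * [1+x]^ n f k
  [1+x]^-* zero    d f k = refl
  [1+x]^-* (suc n) d f k = trans
    (cong₂ _+_ (ih k) (trans (shift-cong ih k) (shift-* d ([1+x]^ n f) k)))
    (sym (*-distribˡ-+ d ([1+x]^ n f k) (shift ([1+x]^ n f) k)))
    where ih = [1+x]^-* n d f

  [1+x]^-shift : ∀ n f → [1+x]^ n (shift f) ≗ shift ([1+x]^ n f)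
  [1+x]^-shift zero    f k = refl
  [1+x]^-shift (suc n) f k = trans (cong₂ _+_ (ih k) (shift-cong ih k))
    (sym (shift-+ ([1+x]^ n f) (shift ([1+x]^ n f)) k))
    where ih = [1+x]^-shift n f

  [1+x]^-C : ∀ m n → [1+x]^ m (n C_) ≗ (m + n) C_
  [1+x]^-C zero    n k = refl
  [1+x]^-C (suc m) n k = trans (cong₂ _+_ (ih k) (shift-cong ih k)) (sym (pascal (m + n) k))
    where ih = [1+x]^-C m n

  -- A form of log-concavity that excludes internal zeros and is therefore
  -- preserved by multiplication with 1 + x.
  record RatiosDecrease (f : Seq) : Set where
    field ratio : ∀ i j → i ≤ j → f i * f (suc j) ≤ f (suc i) * f j

  open RatiosDecrease

  rd-cong : ∀ {f g} → f ≗ g → RatiosDecrease f → RatiosDecrease g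
  rd-cong f≗g rd .ratio i j i≤j =
    subst₂ _≤_ (cong₂ _*_ (f≗g i) (f≗g (suc j))) (cong₂ _*_ (f≗g (suc i)) (f≗g j)) (ratio rd i j i≤j)

  -- One unit of index is moved from the right factor to the left one, twice. The second move needs
  -- `suc i ≤ j`; in the remaining case `i = j` the two sides agree up to order.
  rd-outer : ∀ {f} → RatiosDecrease f → ∀ i j → i ≤ j →
             f i * f (suc (suc j)) ≤ f (suc (suc i)) * f j
  rd-outer {f} rd i j i≤j with m≤n⇒m<n∨m≡n i≤j
  ... | inj₁ i<j  = ≤-trans (ratio rd i (suc j) (m≤n⇒m≤1+n i≤j)) (ratio rd (suc i) j i<j)
  ... | inj₂ refl = ≤-reflexive (*-comm (f i) (f (suc (suc i))))

  -- Multiplied out, both sides consist of four products that compare one by one: two pairs by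
  -- `ratio`, one by `rd-outer`, and `f (1 + i) * f (1 + j)` is common to both sides. At `i = 0` the
  -- missing coefficient `f (-1)` counts as zero.
  rd-[1+x] : ∀ {f} → RatiosDecrease f → RatiosDecrease ([1+x] f)
  rd-[1+x] {f} rd .ratio zero zero _ = ≤-reflexive (*-comm (f 0 + 0) (f 1 + f 0))
  rd-[1+x] {f} rd .ratio zero (suc j) _ = begin
    (f 0 + 0) * (f (2 + j) + f (1 + j))
      ≡⟨ expand₁ (f 0) (f (2 + j)) (f (1 + j)) ⟩
    f 0 * f (2 + j) + f 0 * f (1 + j)
      ≤⟨ +-mono-≤ (ratio rd 0 (suc j) z≤n) (m≤m+n _ _) ⟩
    f 1 * f (1 + j) + (f 0 * f (1 + j) + (f 1 + f 0) * f j)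
      ≡⟨ expand₂ (f 0) (f 1) (f (1 + j)) (f j) ⟩
    (f 1 + f 0) * (f (1 + j) + f j) ∎
    where
    open ≤-Reasoning
    expand₁ : ∀ u v w → (u + 0) * (v + w) ≡ u * v + u * w
    expand₁ = solve-∀
    expand₂ : ∀ u v w x → v * w + (u * w + (v + u) * x) ≡ (v + u) * (w + x)
    expand₂ = solve-∀
  rd-[1+x] {f} rd .ratio (suc i) (suc j) (s≤s i≤j) = begin
    (f (1 + i) + f i) * (f (2 + j) + f (1 + j))
      ≡⟨ expand₁ (f (1 + i)) (f i) (f (2 + j)) (f (1 + j)) ⟩
    (f (1 + i) * f (2 + j) + f i * f (2 + j)) + (f (1 + i) * f (1 + j) + f i * f (1 + j))
      ≤⟨ +-mono-≤ (+-mono-≤ (ratio rd (1 + i) (1 + j) (s≤s i≤j)) (rd-outer rd i j i≤j))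
                  (+-monoʳ-≤ (f (1 + i) * f (1 + j)) (ratio rd i j i≤j)) ⟩
    (f (2 + i) * f (1 + j) + f (2 + i) * f j) + (f (1 + i) * f (1 + j) + f (1 + i) * f j)
      ≡⟨ expand₂ (f (2 + i)) (f (1 + i)) (f (1 + j)) (f j) ⟩
    (f (2 + i) + f (1 + i)) * (f (1 + j) + f j) ∎
    where
    open ≤-Reasoning
    expand₁ : ∀ u v w x → (u + v) * (w + x) ≡ (u * w + v * w) + (u * x + v * x)
    expand₁ = solve-∀
    expand₂ : ∀ u v w x → (u * w + u * x) + (v * w + v * x) ≡ (u + v) * (w + x)
    expand₂ = solve-∀

  rd-[1+x]^ : ∀ n {f} → RatiosDecrease f → RatiosDecrease ([1+x]^ n f)
  rd-[1+x]^ zero    rd = rd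
  rd-[1+x]^ (suc n) rd = rd-[1+x] (rd-[1+x]^ n rd)

  rd-C : ∀ n → RatiosDecrease (n C_)
  rd-C n = rd-cong (λ k → trans ([1+x]^-C n 0 k) (cong (_C k) (+-identityʳ n)))
                   (rd-[1+x]^ n rd-1)
    where
    rd-1 : RatiosDecrease (0 C_)
    rd-1 .ratio i j _ = subst (_≤ (0 C suc i) * (0 C j)) (sym (*-zeroʳ (0 C i))) z≤n

  -- The head occurs only in the pairs with `i = 0`, and the pair `i = j = 0` is commutativity; so a
  -- condition is left only for positive second index.
  rd-changeHead : ∀ {f g} → RatiosDecrease f → (∀ k → g (suc k) ≡ f (suc k)) →
                  (∀ j → g 0 * f (2 + j) ≤ f 1 * f (suc j)) → RatiosDecrease g
  rd-changeHead {f} {g} rd eq h .ratio zero zero _ = ≤-reflexive (*-comm (g 0) (g 1))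
  rd-changeHead {f} {g} rd eq h .ratio zero (suc j) _ rewrite eq (suc j) | eq j | eq 0 = h j
  rd-changeHead {f} {g} rd eq h .ratio (suc i) (suc j) i≤j
    rewrite eq i | eq (suc j) | eq (suc i) | eq j = ratio rd (suc i) (suc j) i≤j

  rd-lowerHead : ∀ {f g} → RatiosDecrease f → g 0 ≤ f 0 → (∀ k → g (suc k) ≡ f (suc k)) →
                 RatiosDecrease g
  rd-lowerHead {f} rd g0≤f0 eq = rd-changeHead rd eq λ j →
    ≤-trans (*-monoˡ-≤ (f (2 + j)) g0≤f0) (ratio rd 0 (suc j) z≤n)

  -- For `i = 0` a larger `g 1` can only help, as it stands on the right. For `i = 1` it stands on
  -- the left: the last hypothesis is the case `j = 2`, and larger `j` follow from it because the
  -- ratios of `f` decrease from index 2 on. This chaining cancels `f 2`, which must be positive.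
  rd-raiseAt1 : ∀ {f g} → RatiosDecrease f → 0 < f 2 → g 0 ≡ f 0 → f 1 ≤ g 1 →
                (∀ k → g (2 + k) ≡ f (2 + k)) → g 1 * f 3 ≤ f 2 * f 2 → RatiosDecrease g
  rd-raiseAt1 {f} {g} rd 0<f2 eq₀ f1≤g1 eq key = rd-g
    where
    open ≤-Reasoning
    instance
      f2≢0 : NonZero (f 2)
      f2≢0 = >-nonZero 0<f2
    rd-g : RatiosDecrease g
    rd-g .ratio zero zero _ = ≤-reflexive (*-comm (g 0) (g 1))
    rd-g .ratio zero (suc zero) _ rewrite eq₀ | eq 0 =
      ≤-trans (ratio rd 0 1 z≤n) (*-mono-≤ f1≤g1 f1≤g1)
    rd-g .ratio zero (suc (suc j)) _ rewrite eq₀ | eq (suc j) | eq j =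
      ≤-trans (ratio rd 0 (2 + j) z≤n) (*-monoˡ-≤ (f (2 + j)) f1≤g1)
    rd-g .ratio (suc zero) (suc zero) _ = ≤-reflexive (*-comm (g 1) (g 2))
    rd-g .ratio (suc zero) (suc (suc j)) _ rewrite eq (suc j) | eq 0 | eq j =
      *-cancelˡ-≤ (f 2) (begin
        f 2 * (g 1 * f (3 + j)) ≡⟨ x∙yz≈y∙xz (f 2) (g 1) (f (3 + j)) ⟩
        g 1 * (f 2 * f (3 + j)) ≤⟨ *-monoʳ-≤ (g 1) (ratio rd 2 (2 + j) (s≤s (s≤s z≤n))) ⟩
        g 1 * (f 3 * f (2 + j)) ≡⟨ *-assoc (g 1) (f 3) (f (2 + j)) ⟨
        g 1 * f 3 * f (2 + j)   ≤⟨ *-monoˡ-≤ (f (2 + j)) key ⟩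
        f 2 * f 2 * f (2 + j)   ≡⟨ *-assoc (f 2) (f 2) (f (2 + j)) ⟩
        f 2 * (f 2 * f (2 + j)) ∎)
    rd-g .ratio (suc (suc i)) (suc (suc j)) i≤j
      rewrite eq i | eq (suc j) | eq (suc i) | eq j = ratio rd (2 + i) (2 + j) i≤j
    rd-g .ratio (suc (suc i)) (suc zero) (s≤s ())

  -- Small binomial coefficients, and log-concavity of `(1 + x)^b + (1 + x)^c - 1`.

  2*nC2+n≡n² : ∀ n → 2 * (n C 2) + n ≡ n * n
  2*nC2+n≡n² zero    = refl
  2*nC2+n≡n² (suc n) = begin
    2 * (suc n C 2) + suc n       ≡⟨ cong (λ z → 2 * z + suc n) (pascal n 2) ⟩
    2 * (n C 2 + n C 1) + suc n   ≡⟨ cong (λ z → 2 * (n C 2 + z) + suc n) (nC1≡n n) ⟩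
    2 * (n C 2 + n) + suc n       ≡⟨ lhs (n C 2) n ⟩
    2 * (n C 2) + n + (2 * n + 1) ≡⟨ cong (_+ (2 * n + 1)) (2*nC2+n≡n² n) ⟩
    n * n + (2 * n + 1)           ≡⟨ rhs n ⟩
    suc n * suc n                 ∎
    where
    open ≡-Reasoning
    lhs : ∀ x n → 2 * (x + n) + suc n ≡ 2 * x + n + (2 * n + 1)
    lhs = solve-∀
    rhs : ∀ n → n * n + (2 * n + 1) ≡ suc n * suc n
    rhs = solve-∀

  6*nC3+3*n²≡n³+2*n : ∀ n → 6 * (n C 3) + 3 * (n * n) ≡ n * n * n + 2 * n
  6*nC3+3*n²≡n³+2*n zero    = refl
  -- The additional `3 * n` completes the `6 * (n C 2)` from Pascal's rule to three copies of the
  -- identity for `n C 2`.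
  6*nC3+3*n²≡n³+2*n (suc n) = +-cancelʳ-≡ (3 * n) _ _ (begin
    6 * (suc n C 3) + 3 * (suc n * suc n) + 3 * n
      ≡⟨ cong (λ z → 6 * z + 3 * (suc n * suc n) + 3 * n) (pascal n 3) ⟩
    6 * (n C 3 + n C 2) + 3 * (suc n * suc n) + 3 * n
      ≡⟨ lhs (n C 3) (n C 2) n ⟩
    (6 * (n C 3) + 3 * (n * n)) + 3 * (2 * (n C 2) + n) + (6 * n + 3)
      ≡⟨ cong₂ (λ y z → y + 3 * z + (6 * n + 3)) (6*nC3+3*n²≡n³+2*n n) (2*nC2+n≡n² n) ⟩
    (n * n * n + 2 * n) + 3 * (n * n) + (6 * n + 3)
      ≡⟨ rhs n ⟩
    suc n * suc n * suc n + 2 * suc n + 3 * n ∎)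
    where
    open ≡-Reasoning
    lhs : ∀ x y n → 6 * (x + y) + 3 * (suc n * suc n) + 3 * n
                  ≡ (6 * x + 3 * (n * n)) + 3 * (2 * y + n) + (6 * n + 3)
    lhs = solve-∀
    rhs : ∀ n → (n * n * n + 2 * n) + 3 * (n * n) + (6 * n + 3)
              ≡ suc n * suc n * suc n + 2 * suc n + 3 * n
    rhs = solve-∀

  -- For positive `n`, the ratios of binomial coefficients from index 1 on are at most
  -- `(n C 2) / (n C 1) = (n - 1) / 2`. The bound `n / 2` is what `(1 + x)^n + 1` asks for, since
  -- its constant coefficient is 2 and its first ratio is therefore `n / 2`.
  2*nC[2+k]≤n*nC[1+k] : ∀ n k → 2 * (n C (2 + k)) ≤ n * (n C (1 + k))
  2*nC[2+k]≤n*nC[1+k] zero    k = z≤n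
  2*nC[2+k]≤n*nC[1+k] n@(suc m) k = *-cancelˡ-≤ n (begin
    n * (2 * (n C (2 + k)))       ≡⟨ x∙yz≈y∙xz n 2 (n C (2 + k)) ⟩
    2 * (n * (n C (2 + k)))       ≡⟨ cong (λ z → 2 * (z * (n C (2 + k)))) (nC1≡n n) ⟨
    2 * ((n C 1) * (n C (2 + k))) ≤⟨ *-monoʳ-≤ 2 (ratio (rd-C n) 1 (1 + k) (s≤s z≤n)) ⟩
    2 * ((n C 2) * (n C (1 + k))) ≡⟨ *-assoc 2 (n C 2) (n C (1 + k)) ⟨
    2 * (n C 2) * (n C (1 + k))   ≤⟨ *-monoˡ-≤ (n C (1 + k)) (m≤m+n (2 * (n C 2)) n) ⟩
    (2 * (n C 2) + n) * (n C (1 + k)) ≡⟨ cong (_* (n C (1 + k))) (2*nC2+n≡n² n) ⟩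
    n * n * (n C (1 + k))         ≡⟨ *-assoc n n (n C (1 + k)) ⟩
    n * (n * (n C (1 + k)))       ∎)
    where
    open ≤-Reasoning

  rd-C+1 : ∀ n → RatiosDecrease (λ k → n C k + 0 C k)
  rd-C+1 n = rd-changeHead (rd-C n) (λ k → +-identityʳ (n C suc k)) λ j →
    subst (λ z → 2 * (n C (2 + j)) ≤ z * (n C suc j)) (sym (nC1≡n n)) (2*nC[2+k]≤n*nC[1+k] n j)

  -- Here f is (1 + x)^(m + n) + (1 + x)^m - 1 = (1 + x)^m ((1 + x)^n + 1) - 1.
  rd-C+C∸1-ordered : ∀ m n {f} → (∀ k → f k + 0 C k ≡ (m + n) C k + m C k) → RatiosDecrease f
  rd-C+C∸1-ordered m n {f} eq = rd-lowerHead (rd-cong expand (rd-[1+x]^ m (rd-C+1 n)))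
    (≤-trans (m≤m+n (f 0) 1) (≤-reflexive (eq 0)))
    (λ k → trans (sym (+-identityʳ (f (suc k)))) (eq (suc k)))
    where
    expand : [1+x]^ m (λ k → n C k + 0 C k) ≗ λ k → (m + n) C k + m C k
    expand k = trans ([1+x]^-+ m (n C_) (0 C_) k) (cong₂ _+_ ([1+x]^-C m n k)
      (trans ([1+x]^-C m 0 k) (cong (_C k) (+-identityʳ m))))

  -- In the application the exponents are `q - 1` and `p (p - 1)`, and `p < q` does not decide which
  -- is larger. The smaller power is factored out.
  rd-C+C∸1 : ∀ b c {f} → (∀ k → f k + 0 C k ≡ b C k + c C k) → RatiosDecrease f
  rd-C+C∸1 b c {f} eq with ≤-total b c
  ... | inj₁ b≤c = rd-C+C∸1-ordered b (c ∸ b) λ k → trans (eq k)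
    (trans (+-comm (b C k) (c C k)) (cong (λ z → z C k + b C k) (sym (m+[n∸m]≡n b≤c))))
  ... | inj₂ c≤b = rd-C+C∸1-ordered c (b ∸ c) λ k → trans (eq k)
    (cong (λ z → z C k + c C k) (sym (m+[n∸m]≡n c≤b)))

  -- The first coefficients of (1 + x)^e ((1 + x)^b + (1 + x)^c - 1) for b = 2 + β
  -- and c = 2 + γ.
  module LowCoefficients (e β γ : ℕ) {f : Seq}
    (eq : ∀ k → f k + e C k ≡ (e + (2 + β)) C k + (e + (2 + γ)) C k) where

    private
      b c u v : ℕ
      b = 2 + β
      c = 2 + γ
      u = e + b
      v = e + c

    open ≡-Reasoning

    f1-eq : f 1 ≡ e + b + c
    f1-eq = +-cancelʳ-≡ e _ _ (begin
      f 1 + e         ≡⟨ cong (f 1 +_) (nC1≡n e) ⟨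
      f 1 + e C 1     ≡⟨ eq 1 ⟩
      u C 1 + v C 1   ≡⟨ cong₂ _+_ (nC1≡n u) (nC1≡n v) ⟩
      u + v           ≡⟨ identity e b c ⟩
      e + b + c + e   ∎)
      where
      identity : ∀ e b c → (e + b) + (e + c) ≡ e + b + c + e
      identity = solve-∀

    2*f2-eq : 2 * f 2 ≡ b * (1 + β) + c * (1 + γ) + e * (7 + 2 * β + 2 * γ) + e * e
    -- Twice `f 2` is `u² + v² + e - e² - u - v`; the negative terms are added to both sides.
    2*f2-eq = +-cancelʳ-≡ (e * e + u + v) _ _ (begin
      2 * f 2 + (e * e + u + v)
        ≡⟨ cong (λ z → 2 * f 2 + (z + u + v)) (2*nC2+n≡n² e) ⟨
      2 * f 2 + (2 * (e C 2) + e + u + v)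
        ≡⟨ regroup₁ (f 2) (e C 2) e u v ⟩
      2 * (f 2 + e C 2) + e + u + v
        ≡⟨ cong (λ z → 2 * z + e + u + v) (eq 2) ⟩
      2 * (u C 2 + v C 2) + e + u + v
        ≡⟨ regroup₂ (u C 2) (v C 2) e u v ⟩
      (2 * (u C 2) + u) + (2 * (v C 2) + v) + e
        ≡⟨ cong₂ (λ y z → y + z + e) (2*nC2+n≡n² u) (2*nC2+n≡n² v) ⟩
      u * u + v * v + e
        ≡⟨ identity e β γ ⟩
      b * (1 + β) + c * (1 + γ) + e * (7 + 2 * β + 2 * γ) + e * e + (e * e + u + v) ∎)
      where
      regroup₁ : ∀ x y e u v → 2 * x + (2 * y + e + u + v) ≡ 2 * (x + y) + e + u + v
      regroup₁ = solve-∀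
      regroup₂ : ∀ x y e u v → 2 * (x + y) + e + u + v ≡ (2 * x + u) + (2 * y + v) + e
      regroup₂ = solve-∀
      identity : ∀ e β γ → let b = 2 + β; c = 2 + γ; u = e + b; v = e + c in
        u * u + v * v + e ≡ b * (1 + β) + c * (1 + γ) + e * (7 + 2 * β + 2 * γ) + e * e + (e * e + u + v)
      identity = solve-∀

    -- The right side is `u (u - 1) (u - 2) + v (v - 1) (v - 2) - e (e - 1) (e -
    -- 2)` arranged by powers of `e`. With `b` and `c` at least 2, written as `2 + β` and `2 + γ`,
    -- every coefficient is free of subtraction.
    6*f3-eq : 6 * f 3 ≡ b * (1 + β) * β + c * (1 + γ) * γ
                      + e * (3 * (b * β) + 3 * (c * γ) + 2) + 3 * (e * e) * (3 + β + γ) + e * e * e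
    6*f3-eq = +-cancelʳ-≡ (e * e * e + 2 * e + 3 * (u * u) + 3 * (v * v)) _ _ (begin
      6 * f 3 + (e * e * e + 2 * e + 3 * (u * u) + 3 * (v * v))
        ≡⟨ cong (λ z → 6 * f 3 + (z + 3 * (u * u) + 3 * (v * v))) (6*nC3+3*n²≡n³+2*n e) ⟨
      6 * f 3 + (6 * (e C 3) + 3 * (e * e) + 3 * (u * u) + 3 * (v * v))
        ≡⟨ regroup₁ (f 3) (e C 3) (e * e) (u * u) (v * v) ⟩
      6 * (f 3 + e C 3) + 3 * (e * e) + 3 * (u * u) + 3 * (v * v)
        ≡⟨ cong (λ z → 6 * z + 3 * (e * e) + 3 * (u * u) + 3 * (v * v)) (eq 3) ⟩
      6 * (u C 3 + v C 3) + 3 * (e * e) + 3 * (u * u) + 3 * (v * v)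
        ≡⟨ regroup₂ (u C 3) (v C 3) (e * e) (u * u) (v * v) ⟩
      (6 * (u C 3) + 3 * (u * u)) + (6 * (v C 3) + 3 * (v * v)) + 3 * (e * e)
        ≡⟨ cong₂ (λ y z → y + z + 3 * (e * e)) (6*nC3+3*n²≡n³+2*n u) (6*nC3+3*n²≡n³+2*n v) ⟩
      (u * u * u + 2 * u) + (v * v * v + 2 * v) + 3 * (e * e)
        ≡⟨ identity e β γ ⟩
      b * (1 + β) * β + c * (1 + γ) * γ + e * (3 * (b * β) + 3 * (c * γ) + 2)
      + 3 * (e * e) * (3 + β + γ) + e * e * e
        + (e * e * e + 2 * e + 3 * (u * u) + 3 * (v * v)) ∎)
      where
      regroup₁ : ∀ x y r s t → 6 * x + (6 * y + 3 * r + 3 * s + 3 * t)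
                             ≡ 6 * (x + y) + 3 * r + 3 * s + 3 * t
      regroup₁ = solve-∀
      regroup₂ : ∀ x y r s t → 6 * (x + y) + 3 * r + 3 * s + 3 * t
                             ≡ (6 * x + 3 * s) + (6 * y + 3 * t) + 3 * r
      regroup₂ = solve-∀
      identity : ∀ e β γ → let b = 2 + β; c = 2 + γ; u = e + b; v = e + c in
        (u * u * u + 2 * u) + (v * v * v + 2 * v) + 3 * (e * e)
        ≡ b * (1 + β) * β + c * (1 + γ) * γ + e * (3 * (b * β) + 3 * (c * γ) + 2)
          + 3 * (e * e) * (3 + β + γ) + e * e * e
          + (e * e * e + 2 * e + 3 * (u * u) + 3 * (v * v))
      identity = solve-∀

  -- In terms of D and T with p = 2 + D and q = p + 1 + T, the difference
  -- 3 q₂² - 2 (q₁ + d) q₃ has only non-negative coefficients.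
  lowCoefficients-identity : ∀ D T →
    let d = 1 + D; e = d * T; β = D + T; γ = D * (3 + D); b = 2 + β; c = 2 + γ
        q₁ = e + b + c
        q₂ = b * (1 + β) + c * (1 + γ) + e * (7 + 2 * β + 2 * γ) + e * e
        q₃ = b * (1 + β) * β + c * (1 + γ) * γ + e * (3 * (b * β) + 3 * (c * γ) + 2)
             + 3 * (e * e) * (3 + β + γ) + e * e * e
    in 3 * (q₂ * q₂) ≡ 2 * ((q₁ + d) * q₃)
          + (48 + T * (200 + T * (200 + T * (88 + T * 16))) + D * (
            208 + T * (736 + T * (638 + T * (232 + T * 32))) + D * (
            344 + T * (1142 + T * (869 + T * (254 + T * 24))) + D * (
            284 + T * (972 + T * (636 + T * (140 + T * 8))) + D * (
            139 + T * (508 + T * (264 + T * (38 + T))) + D * (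
            58 + T * (174 + T * (60 + T * 4)) + D * (
            26 + T * (38 + T * 6) + D * (
            8 + T * 4 + D))))))))
  lowCoefficients-identity = solve-∀

  -- With `q₂ = 2 * f 2` and `q₃ = 6 * f 3`, the comparison of `2 * ((q₁ + d) * q₃)` with
  -- `3 * (q₂ * q₂)` is 12 times the desired one.
  lowCoefficients-logConcave : ∀ D T {f} → let d = 1 + D; e = d * T in
    (∀ k → f k + e C k ≡ (e + (2 + (D + T))) C k + (e + (2 + D * (3 + D))) C k) →
    (f 1 + d) * f 3 ≤ f 2 * f 2
  lowCoefficients-logConcave D T {f} eq = rescale f1-eq 2*f2-eq 6*f3-eq
    (≤-trans (m≤m+n _ _) (≤-reflexive (sym (lowCoefficients-identity D T))))
    where
    open LowCoefficients ((1 + D) * T) (D + T) (D * (3 + D)) {f} eq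
    regroup₁ : ∀ x y → 2 * (x * (6 * y)) ≡ 12 * (x * y)
    regroup₁ = solve-∀
    regroup₂ : ∀ x → 3 * ((2 * x) * (2 * x)) ≡ 12 * (x * x)
    regroup₂ = solve-∀
    rescale : ∀ {q₁ q₂ q₃} → f 1 ≡ q₁ → 2 * f 2 ≡ q₂ → 6 * f 3 ≡ q₃ →
              2 * ((q₁ + (1 + D)) * q₃) ≤ 3 * (q₂ * q₂) → (f 1 + (1 + D)) * f 3 ≤ f 2 * f 2
    rescale refl refl refl q≤ = *-cancelˡ-≤ 12
      (subst₂ _≤_ (regroup₁ (f 1 + (1 + D)) (f 3)) (regroup₂ (f 2)) q≤)

  -- f = (1 + x)^(a + b) + (1 + x)^(a + c) - (1 + x)^a + d x (1 + x)^c, with the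
  -- negative term moved to the left.
  IndependenceCounts : Seq → (a b c d : ℕ) → Set
  IndependenceCounts f a b c d =
    ∀ k → f k + a C k ≡ (a + b) C k + (a + c) C k + d * shift (c C_) k

  -- Factoring out `(1 + x)^c`, with `p = 2 + D` and `q = p + 1 + T`.

  module _ (D T : ℕ) where

    private
      d b c e : ℕ
      d = 1 + D
      b = 2 + (D + T)
      c = 2 + D * (3 + D)
      e = d * T

      -- This is `(1 + x)^b + (1 + x)^c - 1`: the subtraction affects only the constant coefficient,
      -- where `1 + 1 - 1` is written out.
      f : Seq
      f zero    = 1
      f (suc k) = b C suc k + c C suc k

      f-eq : ∀ k → f k + 0 C k ≡ b C k + c C k
      f-eq zero    = refl
      f-eq (suc k) = +-identityʳ _

      g : Seq
      g = [1+x]^ e f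

      g-eq : ∀ k → g k + e C k ≡ (e + b) C k + (e + c) C k
      g-eq k = begin
        g k + e C k                          ≡⟨ cong (λ z → g k + z C k) (+-identityʳ e) ⟨
        g k + (e + 0) C k                    ≡⟨ cong (g k +_) ([1+x]^-C e 0 k) ⟨
        g k + [1+x]^ e (0 C_) k              ≡⟨ [1+x]^-+ e f (0 C_) k ⟨
        [1+x]^ e (λ k → f k + 0 C k) k       ≡⟨ [1+x]^-cong e f-eq k ⟩
        [1+x]^ e (λ k → b C k + c C k) k     ≡⟨ [1+x]^-+ e (b C_) (c C_) k ⟩
        [1+x]^ e (b C_) k + [1+x]^ e (c C_) k ≡⟨ cong₂ _+_ ([1+x]^-C e b k) ([1+x]^-C e c k) ⟩
        (e + b) C k + (e + c) C k            ∎
        where open ≡-Reasoning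

      h : Seq
      h k = g k + d * shift (0 C_) k

      0<g2 : 0 < g 2
      0<g2 = *-cancelˡ-< 2 0 (g 2)
        -- The right side of `2*f2-eq` begins with `(2 + β) * (1 + β)` and so computes to a
        -- successor.
        (subst (0 <_) (sym (LowCoefficients.2*f2-eq e (D + T) (D * (3 + D)) {g} g-eq)) z<s)

      rd-h : RatiosDecrease h
      rd-h = rd-raiseAt1 (rd-[1+x]^ e (rd-C+C∸1 b c f-eq)) 0<g2
        (trans (cong (g 0 +_) (*-zeroʳ d)) (+-identityʳ (g 0)))
        (m≤m+n (g 1) (d * 1))
        (λ k → trans (cong (g (2 + k) +_) (*-zeroʳ d)) (+-identityʳ (g (2 + k))))
        (subst (λ z → (g 1 + z) * g 3 ≤ g 2 * g 2) (sym (*-identityʳ d))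
               (lowCoefficients-logConcave D T g-eq))

    -- Factoring (1 + x)^c out of s leaves h = g + d x.
    rd-IndependenceCounts-DT : ∀ {s} → IndependenceCounts s (c + e) b c d → RatiosDecrease s
    rd-IndependenceCounts-DT {s} eq = rd-cong (λ k → +-cancelʳ-≡ ((c + e) C k) _ _ (h-eq k)) (rd-[1+x]^ c rd-h)
      where
      open ≡-Reasoning
      h-eq : ∀ k → [1+x]^ c h k + (c + e) C k ≡ s k + (c + e) C k
      h-eq k = begin
        [1+x]^ c h k + (c + e) C k
          ≡⟨ cong (_+ (c + e) C k) ([1+x]^-+ c g (λ k → d * shift (0 C_) k) k) ⟩
        [1+x]^ c g k + [1+x]^ c (λ k → d * shift (0 C_) k) k + (c + e) C k
          ≡⟨ cong (λ z → [1+x]^ c g k + z + (c + e) C k) d*x-eq ⟩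
        [1+x]^ c g k + d * shift (c C_) k + (c + e) C k
          ≡⟨ xy∙z≈xz∙y ([1+x]^ c g k) (d * shift (c C_) k) ((c + e) C k) ⟩
        [1+x]^ c g k + (c + e) C k + d * shift (c C_) k
          ≡⟨ cong (λ z → [1+x]^ c g k + z + d * shift (c C_) k) ([1+x]^-C c e k) ⟨
        [1+x]^ c g k + [1+x]^ c (e C_) k + d * shift (c C_) k
          ≡⟨ cong (_+ d * shift (c C_) k) ([1+x]^-+ c g (e C_) k) ⟨
        [1+x]^ c (λ k → g k + e C k) k + d * shift (c C_) k
          ≡⟨ cong (_+ d * shift (c C_) k) ([1+x]^-cong c g-eq k) ⟩
        [1+x]^ c (λ k → (e + b) C k + (e + c) C k) k + d * shift (c C_) k
          ≡⟨ cong (_+ d * shift (c C_) k) ([1+x]^-+ c ((e + b) C_) ((e + c) C_) k) ⟩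
        [1+x]^ c ((e + b) C_) k + [1+x]^ c ((e + c) C_) k + d * shift (c C_) k
          ≡⟨ cong₂ (λ y z → y + z + d * shift (c C_) k) ([1+x]^-C c (e + b) k) ([1+x]^-C c (e + c) k) ⟩
        (c + (e + b)) C k + (c + (e + c)) C k + d * shift (c C_) k
          ≡⟨ cong₂ (λ y z → y C k + z C k + d * shift (c C_) k) (+-assoc c e b) (+-assoc c e c) ⟨
        (c + e + b) C k + (c + e + c) C k + d * shift (c C_) k
          ≡⟨ eq k ⟨
        s k + (c + e) C k ∎
        where
        d*x-eq : [1+x]^ c (λ k → d * shift (0 C_) k) k ≡ d * shift (c C_) k
        d*x-eq = begin
          [1+x]^ c (λ k → d * shift (0 C_) k) k ≡⟨ [1+x]^-* c d (shift (0 C_)) k ⟩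
          d * [1+x]^ c (shift (0 C_)) k         ≡⟨ cong (d *_) ([1+x]^-shift c (0 C_) k) ⟩
          d * shift ([1+x]^ c (0 C_)) k         ≡⟨ cong (d *_) (shift-cong ([1+x]^-C c 0) k) ⟩
          d * shift ((c + 0) C_) k              ≡⟨ cong (λ z → d * shift (z C_) k) (+-identityʳ c) ⟩
          d * shift (c C_) k                    ∎

  -- Here `d = p - 1` and `b = q - 1`, so `p < q` provides `T` with `q - 1 = p + T`. Then
  -- `(p - 1) (q - 1) = p (p - 1) + (p - 1) T`, which is `a = c + e` with `e = d * T`.
  rd-IndependenceCounts : ∀ D b {f} → let d = suc D in d < b →
    IndependenceCounts f (d * b) b (suc d * d) d → RatiosDecrease f
  rd-IndependenceCounts D b {f} d<b counts with T , refl ← m≤n⇒∃[o]m+o≡n d<b =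
    rd-IndependenceCounts-DT D T
      (subst₂ (λ a c → IndependenceCounts f a (2 + (D + T)) c (suc D)) (a≡ D T) (c≡ D) counts)
    where
    a≡ : ∀ D T → (1 + D) * (1 + (1 + D + T)) ≡ 2 + D * (3 + D) + (1 + D) * T
    a≡ = solve-∀
    c≡ : ∀ D → (2 + D) * (1 + D) ≡ 2 + D * (3 + D)
    c≡ = solve-∀


  -- Counting independent sets by a scan over the residues.

  filter-map : ∀ {A B : Set} {P : Pred B 0ℓ} (P? : Decidable P) (f : A → B) xs →
               filter P? (map f xs) ≡ map f (filter (P? ∘ f) xs)
  filter-map P? f []       = refl
  filter-map P? f (x ∷ xs) with does (P? (f x))
  ... | true  = cong (f x ∷_) (filter-map P? f xs)
  ... | false = filter-map P? f xs

  module _ {m : ℕ} {P : Pred (Subset m) 0ℓ} (P? : Decidable P) where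

    #sets : Seq
    #sets k = length (filter (λ S → ∣ S ∣ ≟ k) (filter P? (allSubsets m)))

  #sets-cong : ∀ {m} {P Q : Pred (Subset m) 0ℓ} (P? : Decidable P) (Q? : Decidable Q) →
               (∀ {S} → P S → Q S) → (∀ {S} → Q S → P S) → #sets P? ≗ #sets Q?
  #sets-cong {m} P? Q? P⊆Q Q⊆P k =
    cong (length ∘ filter (λ S → ∣ S ∣ ≟ k)) (filter-≐ P? Q? (P⊆Q , Q⊆P) (allSubsets m))

  #sets-none : ∀ {m} {P : Pred (Subset m) 0ℓ} (P? : Decidable P) → (∀ S → ¬ P S) →
               ∀ k → #sets P? k ≡ 0
  #sets-none {m} P? ¬P k =
    cong (length ∘ filter (λ S → ∣ S ∣ ≟ k)) (filter-none P? (All.universal ¬P (allSubsets m)))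

  -- Subsets are separated by whether they contain the first element; those that do lose one in size
  -- when it is removed, hence the shift.
  #sets-suc : ∀ {m} {P : Pred (Subset (suc m)) 0ℓ} (P? : Decidable P) k →
              #sets P? k ≡ #sets (P? ∘ (outside Vec.∷_)) k + shift (#sets (P? ∘ (inside Vec.∷_))) k
  #sets-suc {m} P? k = begin
    length (filter size? (filter P? (out ++ ins)))
      ≡⟨ cong (length ∘ filter size?) (filter-++ P? out ins) ⟩
    length (filter size? (filter P? out ++ filter P? ins))
      ≡⟨ cong length (filter-++ size? (filter P? out) (filter P? ins)) ⟩
    length (filter size? (filter P? out) ++ filter size? (filter P? ins))
      ≡⟨ length-++ (filter size? (filter P? out)) ⟩
    length (filter size? (filter P? out)) + length (filter size? (filter P? ins))
      ≡⟨ cong₂ _+_ (through outside) (through inside) ⟩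
    #sets (P? ∘ (outside Vec.∷_)) k
      + length (filter (λ S → suc ∣ S ∣ ≟ k) (filter (P? ∘ (inside Vec.∷_)) (allSubsets m)))
      ≡⟨ cong (#sets (P? ∘ (outside Vec.∷_)) k +_) (size-suc k) ⟩
    #sets (P? ∘ (outside Vec.∷_)) k + shift (#sets (P? ∘ (inside Vec.∷_))) k ∎
    where
    open ≡-Reasoning
    size? : Decidable (λ (S : Subset (suc m)) → ∣ S ∣ ≡ k)
    size? S = ∣ S ∣ ≟ k
    out ins : List (Subset (suc m))
    out = map (outside Vec.∷_) (allSubsets m)
    ins = map (inside Vec.∷_) (allSubsets m)
    through : ∀ x → length (filter size? (filter P? (map (x Vec.∷_) (allSubsets m))))
                  ≡ length (filter (size? ∘ (x Vec.∷_)) (filter (P? ∘ (x Vec.∷_)) (allSubsets m)))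
    through x = begin
      length (filter size? (filter P? (map (x Vec.∷_) (allSubsets m))))
        ≡⟨ cong (length ∘ filter size?) (filter-map P? (x Vec.∷_) (allSubsets m)) ⟩
      length (filter size? (map (x Vec.∷_) (filter (P? ∘ (x Vec.∷_)) (allSubsets m))))
        ≡⟨ cong length (filter-map size? (x Vec.∷_) (filter (P? ∘ (x Vec.∷_)) (allSubsets m))) ⟩
      length (map (x Vec.∷_) (filter (size? ∘ (x Vec.∷_)) (filter (P? ∘ (x Vec.∷_)) (allSubsets m))))
        ≡⟨ length-map (x Vec.∷_) (filter (size? ∘ (x Vec.∷_)) (filter (P? ∘ (x Vec.∷_)) (allSubsets m))) ⟩
      length (filter (size? ∘ (x Vec.∷_)) (filter (P? ∘ (x Vec.∷_)) (allSubsets m))) ∎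
    size-suc : ∀ k → length (filter (λ S → suc ∣ S ∣ ≟ k) (filter (P? ∘ (inside Vec.∷_)) (allSubsets m)))
                   ≡ shift (#sets (P? ∘ (inside Vec.∷_))) k
    size-suc zero    = cong length (filter-none (λ S → suc ∣ S ∣ ≟ 0)
      (All.universal (λ _ ()) (filter (P? ∘ (inside Vec.∷_)) (allSubsets m))))
    size-suc (suc k) = cong length (filter-≐ (λ S → suc ∣ S ∣ ≟ suc k) (λ S → ∣ S ∣ ≟ k)
      (suc-injective , cong suc) (filter (P? ∘ (inside Vec.∷_)) (allSubsets m)))

  -- The residue classes modulo p²q, by their greatest common divisor with p²q.
  data Class : Set where
    [1] [p] [p²] [q] [pq] [0] : Class

  p∣ p²∣ q∣ : Class → Bool
  p∣ [1]  = false
  p∣ [p]  = true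
  p∣ [p²] = true
  p∣ [q]  = false
  p∣ [pq] = true
  p∣ [0]  = true
  p²∣ [1]  = false
  p²∣ [p]  = false
  p²∣ [p²] = true
  p²∣ [q]  = false
  p²∣ [pq] = false
  p²∣ [0]  = true
  q∣ [1]  = false
  q∣ [p]  = false
  q∣ [p²] = false
  q∣ [q]  = true
  q∣ [pq] = true
  q∣ [0]  = true

  -- A product vanishes modulo p²q when `q` divides one of the factors and the two factors `p` come
  -- either both from one side or one from each.
  product≢0 : Class → Class → Bool
  product≢0 x y = not ((q∣ x ∨ q∣ y) ∧ ((p²∣ x ∨ p²∣ y) ∨ (p∣ x ∧ p∣ y)))

  product≢0-sym : ∀ x y → product≢0 x y ≡ product≢0 y x
  product≢0-sym x y = cong not (cong₂ _∧_ (∨-comm (q∣ x) (q∣ y))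
    (cong₂ _∨_ (∨-comm (p²∣ x) (p²∣ y)) (∧-comm (p∣ x) (p∣ y))))

  -- The vertex classes from which elements may still be added to a set.
  record Allowed : Set where
    constructor allow
    field a[p] a[p²] a[q] a[pq] : Bool

  open Allowed

  allows : Allowed → Class → Bool
  allows σ [1]  = false
  allows σ [p]  = a[p] σ
  allows σ [p²] = a[p²] σ
  allows σ [q]  = a[q] σ
  allows σ [pq] = a[pq] σ
  allows σ [0]  = false

  restrict : Allowed → Class → Allowed
  restrict σ x = allow (a[p] σ ∧ product≢0 x [p]) (a[p²] σ ∧ product≢0 x [p²])
                       (a[q] σ ∧ product≢0 x [q]) (a[pq] σ ∧ product≢0 x [pq])

  allows-restrict : ∀ σ x y → allows (restrict σ x) y ≡ allows σ y ∧ product≢0 x y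
  allows-restrict σ x [1]  = refl
  allows-restrict σ x [p]  = refl
  allows-restrict σ x [p²] = refl
  allows-restrict σ x [q]  = refl
  allows-restrict σ x [pq] = refl
  allows-restrict σ x [0]  = refl

  -- Independence as a scan whose whole memory is the set of classes still available. An element
  -- restricts only those after it, never itself, so a residue with square zero may be chosen
  -- although its class then excludes further members.
  extensible : ∀ {m} → Allowed → (Fin m → Class) → Subset m → Bool
  extensible σ cls Vec.[]           = true
  extensible σ cls (outside Vec.∷ S) = extensible σ (cls ∘ Fin.suc) S
  extensible σ cls (inside Vec.∷ S)  =
    allows σ (cls Fin.zero) ∧ extensible (restrict σ (cls Fin.zero)) (cls ∘ Fin.suc) S

  IndependentIn : ∀ {m} → Allowed → (Fin m → Class) → Subset m → Set
  IndependentIn σ cls S =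
    (∀ a → a ∈ S → T (allows σ (cls a))) ×
    (∀ a b → a ∈ S → b ∈ S → a ≢ b → T (product≢0 (cls a) (cls b)))

  independentIn⇒extensible : ∀ {m} σ (cls : Fin m → Class) {S} →
                             IndependentIn σ cls S → T (extensible σ cls S)
  independentIn⇒extensible σ cls {Vec.[]}           _             = tt
  independentIn⇒extensible σ cls {outside Vec.∷ S} (allowed , indep) =
    independentIn⇒extensible σ (cls ∘ Fin.suc)
      ( (λ a a∈S → allowed (Fin.suc a) (there a∈S))
      , (λ a b a∈S b∈S a≢b → indep _ _ (there a∈S) (there b∈S) (a≢b ∘ Fin.suc-injective)))
  independentIn⇒extensible σ cls {inside Vec.∷ S}  (allowed , indep) =
    Equivalence.from T-∧ (allowed Fin.zero here ,
    independentIn⇒extensible (restrict σ (cls Fin.zero)) (cls ∘ Fin.suc)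
      ( (λ a a∈S → subst T (sym (allows-restrict σ (cls Fin.zero) (cls (Fin.suc a))))
          (Equivalence.from T-∧ ( allowed (Fin.suc a) (there a∈S)
                                , indep Fin.zero (Fin.suc a) here (there a∈S) λ ())))
      , (λ a b a∈S b∈S a≢b → indep _ _ (there a∈S) (there b∈S) (a≢b ∘ Fin.suc-injective))))

  extensible⇒independentIn : ∀ {m} σ (cls : Fin m → Class) {S} →
                             T (extensible σ cls S) → IndependentIn σ cls S
  extensible⇒independentIn σ cls {Vec.[]} _ = (λ _ ()) , (λ _ _ ())
  extensible⇒independentIn σ cls {outside Vec.∷ S} ext
    with allowed , indep ← extensible⇒independentIn σ (cls ∘ Fin.suc) {S} ext =
      (λ { (Fin.suc a) (there a∈S) → allowed a a∈S })
    , (λ { (Fin.suc a) (Fin.suc b) (there a∈S) (there b∈S) a≢b →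
           indep a b a∈S b∈S (a≢b ∘ cong Fin.suc) })
  extensible⇒independentIn σ cls {inside Vec.∷ S} ext
    with allowed₀ , ext′ ← Equivalence.to T-∧ ext
    with allowed , indep ← extensible⇒independentIn (restrict σ (cls Fin.zero)) (cls ∘ Fin.suc) {S} ext′ =
      (λ { Fin.zero _ → allowed₀
         ; (Fin.suc a) (there a∈S) → proj₁ (both a a∈S) })
    , (λ { Fin.zero Fin.zero _ _ 0≢0 → contradiction refl 0≢0
         ; Fin.zero (Fin.suc b) _ (there b∈S) _ → proj₂ (both b b∈S)
         -- The scan tests a pair only in the order of its elements; symmetry supplies the reverse
         -- order.
         ; (Fin.suc a) Fin.zero (there a∈S) _ _ →
             subst T (product≢0-sym (cls Fin.zero) (cls (Fin.suc a))) (proj₂ (both a a∈S))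
         ; (Fin.suc a) (Fin.suc b) (there a∈S) (there b∈S) a≢b →
             indep a b a∈S b∈S (a≢b ∘ cong Fin.suc) })
    where
    both : ∀ a → a ∈ S → T (allows σ (cls (Fin.suc a))) × T (product≢0 (cls Fin.zero) (cls (Fin.suc a)))
    both a a∈S = Equivalence.to T-∧
      (subst T (allows-restrict σ (cls Fin.zero) (cls (Fin.suc a))) (allowed a a∈S))

  #extensible : ∀ {m} → Allowed → (Fin m → Class) → Seq
  #extensible σ cls = #sets (λ S → T? (extensible σ cls S))

  extend : Bool → Seq → Seq
  extend b f k = if b then shift f k else 0

  #extensible-suc : ∀ {m} σ (cls : Fin (suc m) → Class) k → #extensible σ cls k ≡
    #extensible σ (cls ∘ Fin.suc) k
      + extend (allows σ (cls Fin.zero)) (#extensible (restrict σ (cls Fin.zero)) (cls ∘ Fin.suc)) k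
  #extensible-suc σ cls k = trans (#sets-suc (λ S → T? (extensible σ cls S)) k)
    (cong (#extensible σ (cls ∘ Fin.suc) k +_)
      (choose (allows σ (cls Fin.zero)) (extensible (restrict σ (cls Fin.zero)) (cls ∘ Fin.suc)) k))
    where
    choose : ∀ {m} b (φ : Subset m → Bool) → shift (#sets (λ S → T? (b ∧ φ S))) ≗ extend b (#sets (T? ∘ φ))
    choose true  φ k       = refl
    choose false φ zero    = refl
    choose {m} false φ (suc k) = #sets-none {m} (λ S → T? false) (λ _ ()) k

  δ : Class → Class → ℕ
  δ [1]  [1]  = 1
  δ [p]  [p]  = 1
  δ [p²] [p²] = 1
  δ [q]  [q]  = 1
  δ [pq] [pq] = 1
  δ [0]  [0]  = 1
  δ _    _    = 0

  #[_] : Class → ∀ {m} → (Fin m → Class) → ℕ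
  #[ x ] cls = sum (δ x ∘ cls)

  #extensible-[] : ∀ σ (cls : Fin 0 → Class) → #extensible σ cls ≗ 0 C_
  #extensible-[] σ cls zero    = refl
  #extensible-[] σ cls (suc k) = refl

  shift-+-+ : ∀ {f g h l} → (∀ k → f k + g k ≡ h k + l k) →
              ∀ k → shift f k + shift g k ≡ shift h k + shift l k
  shift-+-+ eq zero    = refl
  shift-+-+ eq (suc k) = eq k

  pascal-suc : ∀ n f k → f ≗ n C_ → f k + shift f k ≡ suc n C k
  pascal-suc n f k f≗C = trans (cong₂ _+_ (f≗C k) (shift-cong f≗C k)) (sym (pascal n k))

  pascal-+ : ∀ m n k → (m + suc n) C k ≡ (m + n) C k + shift ((m + n) C_) k
  pascal-+ m n k = trans (cong (_C k) (+-suc m n)) (pascal (m + n) k)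

  -- These six states are the ones reachable from `vertices` by choosing allowed classes. Choosing
  -- `[p]`, `[p²]`, `[q]`, `[pq]` there leads to `no-pq`, `p-or-p²`, `no-p²`, `only-q`; the state
  -- `p-or-q` arises from `no-pq` by `[q]` and from `no-p²` by `[p]`.
  only-q p-or-p² p-or-q no-pq no-p² vertices : Allowed
  only-q   = allow false false true false
  p-or-p²  = allow true true false false
  p-or-q   = allow true false true false
  no-pq    = allow true true true false
  no-p²    = allow true false true true
  vertices = allow true true true true

  -- This state, like `p-or-p²` and `p-or-q`, is unchanged by choosing an allowed class. Each
  -- residue of an allowed class thus contributes a free factor `1 + x`, and every other residue a
  -- factor 1.
  #only-q : ∀ {m} (cls : Fin m → Class) → #extensible only-q cls ≗ #[ [q] ] cls C_
  #only-q {zero}  cls = #extensible-[] only-q cls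
  #only-q {suc m} cls k rewrite #extensible-suc only-q cls k
    with ih ← #only-q (cls ∘ Fin.suc) | cls Fin.zero
  ... | [q]  = pascal-suc (#[ [q] ] (cls ∘ Fin.suc)) _ k ih
  ... | [1]  = trans (+-identityʳ _) (ih k)
  ... | [p]  = trans (+-identityʳ _) (ih k)
  ... | [p²] = trans (+-identityʳ _) (ih k)
  ... | [pq] = trans (+-identityʳ _) (ih k)
  ... | [0]  = trans (+-identityʳ _) (ih k)

  #p-or-p² : ∀ {m} (cls : Fin m → Class) →
             #extensible p-or-p² cls ≗ (#[ [p] ] cls + #[ [p²] ] cls) C_
  #p-or-p² {zero}  cls = #extensible-[] p-or-p² cls
  #p-or-p² {suc m} cls k rewrite #extensible-suc p-or-p² cls k
    with ih ← #p-or-p² (cls ∘ Fin.suc) | cls Fin.zero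
  ... | [p]  = pascal-suc (#[ [p] ] (cls ∘ Fin.suc) + #[ [p²] ] (cls ∘ Fin.suc)) _ k ih
  ... | [p²] = trans (cong₂ _+_ (ih k) (shift-cong ih k))
                     (sym (pascal-+ (#[ [p] ] (cls ∘ Fin.suc)) (#[ [p²] ] (cls ∘ Fin.suc)) k))
  ... | [1]  = trans (+-identityʳ _) (ih k)
  ... | [q]  = trans (+-identityʳ _) (ih k)
  ... | [pq] = trans (+-identityʳ _) (ih k)
  ... | [0]  = trans (+-identityʳ _) (ih k)

  #p-or-q : ∀ {m} (cls : Fin m → Class) →
            #extensible p-or-q cls ≗ (#[ [p] ] cls + #[ [q] ] cls) C_
  #p-or-q {zero}  cls = #extensible-[] p-or-q cls
  #p-or-q {suc m} cls k rewrite #extensible-suc p-or-q cls k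
    with ih ← #p-or-q (cls ∘ Fin.suc) | cls Fin.zero
  ... | [p]  = pascal-suc (#[ [p] ] (cls ∘ Fin.suc) + #[ [q] ] (cls ∘ Fin.suc)) _ k ih
  ... | [q]  = trans (cong₂ _+_ (ih k) (shift-cong ih k))
                     (sym (pascal-+ (#[ [p] ] (cls ∘ Fin.suc)) (#[ [q] ] (cls ∘ Fin.suc)) k))
  ... | [1]  = trans (+-identityʳ _) (ih k)
  ... | [p²] = trans (+-identityʳ _) (ih k)
  ... | [pq] = trans (+-identityʳ _) (ih k)
  ... | [0]  = trans (+-identityʳ _) (ih k)

  -- Inclusion and exclusion: classes `[p²]` and `[q]` annihilate each other, so a set lacks one of
  -- them, and the sets lacking both are counted twice. Their number stands on the left.
  #no-pq : ∀ {m} (cls : Fin m → Class) k →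
           #extensible no-pq cls k + #[ [p] ] cls C k
           ≡ (#[ [p] ] cls + #[ [p²] ] cls) C k + (#[ [p] ] cls + #[ [q] ] cls) C k
  #no-pq {zero}  cls k = cong (_+ 0 C k) (#extensible-[] no-pq cls k)
  #no-pq {suc m} cls k rewrite #extensible-suc no-pq cls k = step (cls Fin.zero)
    where
    open ≡-Reasoning
    rest = cls ∘ Fin.suc
    N M₁ M₂ : Seq
    N  = #extensible no-pq rest
    M₁ = #extensible p-or-p² rest
    M₂ = #extensible p-or-q rest
    a b c : ℕ
    a = #[ [p] ] rest
    b = #[ [p²] ] rest
    c = #[ [q] ] rest
    ih : ∀ k → N k + a C k ≡ (a + b) C k + (a + c) C k
    ih = #no-pq rest
    unchanged : N k + 0 + a C k ≡ (a + b) C k + (a + c) C k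
    unchanged = trans (cong (_+ a C k) (+-identityʳ (N k))) (ih k)
    step : ∀ x → N k + extend (allows no-pq x) (#extensible (restrict no-pq x) rest) k
                   + (δ [p] x + a) C k
                 ≡ ((δ [p] x + a) + (δ [p²] x + b)) C k + ((δ [p] x + a) + (δ [q] x + c)) C k
    step [p] = begin
      N k + shift N k + suc a C k
        ≡⟨ cong (N k + shift N k +_) (pascal a k) ⟩
      (N k + shift N k) + (a C k + shift (a C_) k)
        ≡⟨ interchange (N k) (shift N k) (a C k) (shift (a C_) k) ⟩
      (N k + a C k) + (shift N k + shift (a C_) k)
        ≡⟨ cong₂ _+_ (ih k) (shift-+-+ ih k) ⟩
      ((a + b) C k + (a + c) C k) + (shift ((a + b) C_) k + shift ((a + c) C_) k)
        ≡⟨ interchange ((a + b) C k) ((a + c) C k) (shift ((a + b) C_) k) (shift ((a + c) C_) k) ⟩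
      ((a + b) C k + shift ((a + b) C_) k) + ((a + c) C k + shift ((a + c) C_) k)
        ≡⟨ cong₂ _+_ (pascal (a + b) k) (pascal (a + c) k) ⟨
      suc (a + b) C k + suc (a + c) C k ∎
    -- Choosing this element rules out class `[q]`, so only the first binomial coefficient gains.
    step [p²] = begin
      N k + shift M₁ k + a C k
        ≡⟨ cong (λ z → N k + z + a C k) (shift-cong (#p-or-p² rest) k) ⟩
      N k + shift ((a + b) C_) k + a C k
        ≡⟨ xy∙z≈xz∙y (N k) (shift ((a + b) C_) k) (a C k) ⟩
      N k + a C k + shift ((a + b) C_) k
        ≡⟨ cong (_+ shift ((a + b) C_) k) (ih k) ⟩
      (a + b) C k + (a + c) C k + shift ((a + b) C_) k
        ≡⟨ xy∙z≈xz∙y ((a + b) C k) ((a + c) C k) (shift ((a + b) C_) k) ⟩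
      (a + b) C k + shift ((a + b) C_) k + (a + c) C k
        ≡⟨ cong (_+ (a + c) C k) (pascal-+ a b k) ⟨
      (a + suc b) C k + (a + c) C k ∎
    step [q] = begin
      N k + shift M₂ k + a C k
        ≡⟨ cong (λ z → N k + z + a C k) (shift-cong (#p-or-q rest) k) ⟩
      N k + shift ((a + c) C_) k + a C k
        ≡⟨ xy∙z≈xz∙y (N k) (shift ((a + c) C_) k) (a C k) ⟩
      N k + a C k + shift ((a + c) C_) k
        ≡⟨ cong (_+ shift ((a + c) C_) k) (ih k) ⟩
      (a + b) C k + (a + c) C k + shift ((a + c) C_) k
        ≡⟨ +-assoc ((a + b) C k) ((a + c) C k) (shift ((a + c) C_) k) ⟩
      (a + b) C k + ((a + c) C k + shift ((a + c) C_) k)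
        ≡⟨ cong ((a + b) C k +_) (pascal-+ a c k) ⟨
      (a + b) C k + (a + suc c) C k ∎
    step [1]  = unchanged
    step [pq] = unchanged
    step [0]  = unchanged

  -- Two residues of class `[pq]` annihilate each other, so their number enters only as a linear
  -- factor; one of them also annihilates class `[p]`, which leaves the exponent of class `[q]`
  -- alone.
  #no-p² : ∀ {m} (cls : Fin m → Class) k →
           #extensible no-p² cls k
           ≡ (#[ [p] ] cls + #[ [q] ] cls) C k + #[ [pq] ] cls * shift (#[ [q] ] cls C_) k
  #no-p² {zero}  cls k = trans (#extensible-[] no-p² cls k) (sym (+-identityʳ (0 C k)))
  #no-p² {suc m} cls k rewrite #extensible-suc no-p² cls k = step (cls Fin.zero)
    where
    open ≡-Reasoning
    rest = cls ∘ Fin.suc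
    N : Seq
    N = #extensible no-p² rest
    a c d : ℕ
    a = #[ [p] ] rest
    c = #[ [q] ] rest
    d = #[ [pq] ] rest
    ih : ∀ k → N k ≡ (a + c) C k + d * shift (c C_) k
    ih = #no-p² rest
    swap′ : ∀ x y z → x + y + z ≡ x + (z + y)
    swap′ = solve-∀
    unchanged : N k + 0 ≡ (a + c) C k + d * shift (c C_) k
    unchanged = trans (+-identityʳ (N k)) (ih k)
    step : ∀ x → N k + extend (allows no-p² x) (#extensible (restrict no-p² x) rest) k
                 ≡ ((δ [p] x + a) + (δ [q] x + c)) C k
                   + (δ [pq] x + d) * shift ((δ [q] x + c) C_) k
    step [p] = begin
      N k + shift (#extensible p-or-q rest) k
        ≡⟨ cong₂ _+_ (ih k) (shift-cong (#p-or-q rest) k) ⟩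
      (a + c) C k + d * shift (c C_) k + shift ((a + c) C_) k
        ≡⟨ xy∙z≈xz∙y ((a + c) C k) (d * shift (c C_) k) (shift ((a + c) C_) k) ⟩
      (a + c) C k + shift ((a + c) C_) k + d * shift (c C_) k
        ≡⟨ cong (_+ d * shift (c C_) k) (pascal (a + c) k) ⟨
      suc (a + c) C k + d * shift (c C_) k ∎
    step [q] = begin
      N k + shift N k
        ≡⟨ cong₂ _+_ (ih k) (shift-cong ih k) ⟩
      (a + c) C k + d * shift (c C_) k + shift (λ k → (a + c) C k + d * shift (c C_) k) k
        ≡⟨ cong ((a + c) C k + d * shift (c C_) k +_)
                (trans (shift-+ ((a + c) C_) (λ k → d * shift (c C_) k) k)
                       (cong (shift ((a + c) C_) k +_) (shift-* d (shift (c C_)) k))) ⟩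
      (a + c) C k + d * shift (c C_) k + (shift ((a + c) C_) k + d * shift (shift (c C_)) k)
        ≡⟨ interchange ((a + c) C k) (d * shift (c C_) k) (shift ((a + c) C_) k) (d * shift (shift (c C_)) k) ⟩
      ((a + c) C k + shift ((a + c) C_) k) + (d * shift (c C_) k + d * shift (shift (c C_)) k)
        ≡⟨ cong (((a + c) C k + shift ((a + c) C_) k) +_) (*-distribˡ-+ d (shift (c C_) k) (shift (shift (c C_)) k)) ⟨
      ((a + c) C k + shift ((a + c) C_) k) + d * (shift (c C_) k + shift (shift (c C_)) k)
        ≡⟨ cong₂ (λ y z → y + d * z) (pascal-+ a c k)
                 (trans (shift-cong (pascal c) k) (shift-+ (c C_) (shift (c C_)) k)) ⟨
      (a + suc c) C k + d * shift (suc c C_) k ∎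
    step [pq] = begin
      N k + shift (#extensible only-q rest) k
        ≡⟨ cong₂ _+_ (ih k) (shift-cong (#only-q rest) k) ⟩
      (a + c) C k + d * shift (c C_) k + shift (c C_) k
        ≡⟨ swap′ ((a + c) C k) (d * shift (c C_) k) (shift (c C_) k) ⟩
      (a + c) C k + suc d * shift (c C_) k ∎
    step [1]  = unchanged
    step [p²] = unchanged
    step [0]  = unchanged

  #vertices : ∀ {m} (cls : Fin m → Class) → IndependenceCounts (#extensible vertices cls)
              (#[ [p] ] cls) (#[ [p²] ] cls) (#[ [q] ] cls) (#[ [pq] ] cls)
  #vertices {zero}  cls k = trans (cong (_+ 0 C k) (#extensible-[] vertices cls k))
                                  (sym (+-identityʳ (0 C k + 0 C k)))
  #vertices {suc m} cls k rewrite #extensible-suc vertices cls k = step (cls Fin.zero)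
    where
    open ≡-Reasoning
    rest = cls ∘ Fin.suc
    N : Seq
    N = #extensible vertices rest
    a b c d : ℕ
    a = #[ [p] ] rest
    b = #[ [p²] ] rest
    c = #[ [q] ] rest
    d = #[ [pq] ] rest
    ih : N k + a C k ≡ (a + b) C k + (a + c) C k + d * shift (c C_) k
    ih = #vertices rest k
    swap₄ : ∀ x y z w → x + y + z + w ≡ (x + w) + y + z
    swap₄ = solve-∀
    swap₅ : ∀ x y z w v → x + y + z + (w + v) ≡ x + (y + w) + (z + v)
    swap₅ = solve-∀
    swap′ : ∀ x y z → x + y + z ≡ x + (z + y)
    swap′ = solve-∀
    unchanged : N k + 0 + a C k ≡ (a + b) C k + (a + c) C k + d * shift (c C_) k
    unchanged = trans (cong (_+ a C k) (+-identityʳ (N k))) ih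
    step : ∀ x → N k + extend (allows vertices x) (#extensible (restrict vertices x) rest) k
                   + (δ [p] x + a) C k
                 ≡ ((δ [p] x + a) + (δ [p²] x + b)) C k + ((δ [p] x + a) + (δ [q] x + c)) C k
                   + (δ [pq] x + d) * shift ((δ [q] x + c) C_) k
    -- Choosing this element excludes class `[pq]`: the other three terms are multiplied by `1 + x`,
    -- while the summand with `d` stays.
    step [p] = begin
      N k + shift M k + suc a C k
        ≡⟨ cong (N k + shift M k +_) (pascal a k) ⟩
      (N k + shift M k) + (a C k + shift (a C_) k)
        ≡⟨ interchange (N k) (shift M k) (a C k) (shift (a C_) k) ⟩
      (N k + a C k) + (shift M k + shift (a C_) k)
        ≡⟨ cong₂ _+_ ih (shift-+-+ (#no-pq rest) k) ⟩
      (a + b) C k + (a + c) C k + d * shift (c C_) k + (shift ((a + b) C_) k + shift ((a + c) C_) k)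
        ≡⟨ regroup ((a + b) C k) ((a + c) C k) (d * shift (c C_) k)
                   (shift ((a + b) C_) k) (shift ((a + c) C_) k) ⟩
      ((a + b) C k + shift ((a + b) C_) k) + ((a + c) C k + shift ((a + c) C_) k) + d * shift (c C_) k
        ≡⟨ cong₂ (λ y z → y + z + d * shift (c C_) k) (pascal (a + b) k) (pascal (a + c) k) ⟨
      suc (a + b) C k + suc (a + c) C k + d * shift (c C_) k ∎
      where
      M : Seq
      M = #extensible no-pq rest
      regroup : ∀ x y z w v → x + y + z + (w + v) ≡ (x + w) + (y + v) + z
      regroup = solve-∀
    step [p²] = begin
      N k + shift (#extensible p-or-p² rest) k + a C k
        ≡⟨ cong (λ z → N k + z + a C k) (shift-cong (#p-or-p² rest) k) ⟩
      N k + shift ((a + b) C_) k + a C k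
        ≡⟨ xy∙z≈xz∙y (N k) (shift ((a + b) C_) k) (a C k) ⟩
      N k + a C k + shift ((a + b) C_) k
        ≡⟨ cong (_+ shift ((a + b) C_) k) ih ⟩
      (a + b) C k + (a + c) C k + d * shift (c C_) k + shift ((a + b) C_) k
        ≡⟨ swap₄ ((a + b) C k) ((a + c) C k) (d * shift (c C_) k) (shift ((a + b) C_) k) ⟩
      ((a + b) C k + shift ((a + b) C_) k) + (a + c) C k + d * shift (c C_) k
        ≡⟨ cong (λ z → z + (a + c) C k + d * shift (c C_) k) (pascal-+ a b k) ⟨
      (a + suc b) C k + (a + c) C k + d * shift (c C_) k ∎
    -- Class `[q]` is compatible with both `[p]` and `[pq]`, so two summands grow at once: the
    -- second binomial coefficient and the one multiplied by `d`.
    step [q] = begin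
      N k + shift M k + a C k
        ≡⟨ cong (λ z → N k + z + a C k) (shift-cong (#no-p² rest) k) ⟩
      N k + shift (λ k → (a + c) C k + d * shift (c C_) k) k + a C k
        ≡⟨ cong (λ z → N k + z + a C k)
                (trans (shift-+ ((a + c) C_) (λ k → d * shift (c C_) k) k)
                       (cong (shift ((a + c) C_) k +_) (shift-* d (shift (c C_)) k))) ⟩
      N k + (shift ((a + c) C_) k + d * shift (shift (c C_)) k) + a C k
        ≡⟨ xy∙z≈xz∙y (N k) (shift ((a + c) C_) k + d * shift (shift (c C_)) k) (a C k) ⟩
      N k + a C k + (shift ((a + c) C_) k + d * shift (shift (c C_)) k)
        ≡⟨ cong (_+ (shift ((a + c) C_) k + d * shift (shift (c C_)) k)) ih ⟩
      (a + b) C k + (a + c) C k + d * shift (c C_) k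
        + (shift ((a + c) C_) k + d * shift (shift (c C_)) k)
        ≡⟨ swap₅ ((a + b) C k) ((a + c) C k) (d * shift (c C_) k)
                 (shift ((a + c) C_) k) (d * shift (shift (c C_)) k) ⟩
      (a + b) C k + ((a + c) C k + shift ((a + c) C_) k)
        + (d * shift (c C_) k + d * shift (shift (c C_)) k)
        ≡⟨ cong ((a + b) C k + ((a + c) C k + shift ((a + c) C_) k) +_)
                (*-distribˡ-+ d (shift (c C_) k) (shift (shift (c C_)) k)) ⟨
      (a + b) C k + ((a + c) C k + shift ((a + c) C_) k)
        + d * (shift (c C_) k + shift (shift (c C_)) k)
        ≡⟨ cong₂ (λ y z → (a + b) C k + y + d * z) (pascal-+ a c k)
                 (trans (shift-cong (pascal c) k) (shift-+ (c C_) (shift (c C_)) k)) ⟨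
      (a + b) C k + (a + suc c) C k + d * shift (suc c C_) k ∎
      where
      M : Seq
      M = #extensible no-p² rest
    step [pq] = begin
      N k + shift (#extensible only-q rest) k + a C k
        ≡⟨ cong (λ z → N k + z + a C k) (shift-cong (#only-q rest) k) ⟩
      N k + shift (c C_) k + a C k
        ≡⟨ xy∙z≈xz∙y (N k) (shift (c C_) k) (a C k) ⟩
      N k + a C k + shift (c C_) k
        ≡⟨ cong (_+ shift (c C_) k) ih ⟩
      (a + b) C k + (a + c) C k + d * shift (c C_) k + shift (c C_) k
        ≡⟨ swap′ ((a + b) C k + (a + c) C k) (d * shift (c C_) k) (shift (c C_) k) ⟩
      (a + b) C k + (a + c) C k + suc d * shift (c C_) k ∎
    step [1]  = unchanged
    step [0]  = unchanged

open Combinatorics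

module ZeroDivisors where

  open import Data.Bool using (Bool; true; false; T; _∧_; _∨_; not)
  open import Data.Bool.Properties using (T-∧; T-∨)
  open import Data.Nat
  open import Data.Nat.Divisibility
  open import Data.Nat.DivMod using (_%_; _mod_; m<n⇒m%n≡m)
  open import Data.Nat.Properties
  open import Data.Unit using (tt)
  open import Defs using (module IntegersMod; Independent; zeroDivisorGraph)
  open import Algebra.Properties.CommutativeMonoid.Sum +-0-commutativeMonoid
    using (sum; sum-cong-≗; sum-replicate-zero; ∑-distrib-+)

  -- Divisibility by p, p² and q, and the classes it defines.

  bit : Bool → ℕ
  bit true  = 1
  bit false = 0

  sum-toℕ-+ : ∀ m n (f : ℕ → ℕ) →
              sum {m + n} (f ∘ toℕ) ≡ sum {m} (f ∘ toℕ) + sum {n} (λ i → f (m + toℕ i))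
  sum-toℕ-+ zero    n f = refl
  sum-toℕ-+ (suc m) n f = trans (cong (f 0 +_) (sum-toℕ-+ m n (f ∘ suc)))
    (sym (+-assoc (f 0) (sum {m} (f ∘ suc ∘ toℕ)) (sum {n} (λ i → f (suc m + toℕ i)))))

  -- The range is cut into `e` blocks of length `d`, and the first entry of each block is its only
  -- multiple of `d`.
  #multiples : ∀ d .{{_ : NonZero d}} e → sum {e * d} (λ i → bit (does (d ∣? toℕ i))) ≡ e
  #multiples d         zero    = refl
  #multiples d@(suc c) (suc e) = begin
    sum {d + e * d} (multiple ∘ toℕ)
      ≡⟨ sum-toℕ-+ d (e * d) multiple ⟩
    sum {d} (multiple ∘ toℕ) + sum {e * d} (λ i → multiple (d + toℕ i))
      ≡⟨ cong₂ _+_ firstBlock (sum-cong-≗ {e * d} λ i → periodic (toℕ i)) ⟩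
    1 + sum {e * d} (multiple ∘ toℕ)
      ≡⟨ cong suc (#multiples d e) ⟩
    suc e ∎
    where
    open ≡-Reasoning
    multiple : ℕ → ℕ
    multiple i = bit (does (d ∣? i))
    periodic : ∀ i → multiple (d + i) ≡ multiple i
    periodic i = cong bit (does-⇔ (mk⇔ (λ d∣d+i → ∣m+n∣m⇒∣n d∣d+i ∣-refl) (∣m∣n⇒∣m+n ∣-refl))
                                  (d ∣? (d + i)) (d ∣? i))
    firstBlock : sum {d} (multiple ∘ toℕ) ≡ 1
    firstBlock = cong₂ _+_ (cong bit (dec-true (d ∣? 0) (d ∣0)))
      (trans (sum-cong-≗ {c} λ i → cong bit (dec-false (d ∣? suc (toℕ i)) (>⇒∤ (s≤s (Fin.toℕ<n i)))))
             (sum-replicate-zero c))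

  -- With `i = k * m`, the prime `q` misses `m` and must divide the cofactor `k`. This serves both
  -- `m = p` and `m = p * p`.
  ∣-*-prime : ∀ {m q i} → Prime q → ¬ q ∣ m → m ∣ i → q ∣ i → m * q ∣ i
  ∣-*-prime {m} {q} q-prime q∤m (divides k refl) q∣km with euclidsLemma k m q-prime q∣km
  ... | inj₁ q∣k = subst (m * q ∣_) (*-comm m k) (*-monoʳ-∣ m q∣k)
  ... | inj₂ q∣m = contradiction q∣m q∤m

  -- Euclid's lemma is applied twice, with one factor `p` cancelled in between.
  p*p∣⇒p*p∣ : ∀ {p} i j → Prime p → ¬ p ∣ i → p * p ∣ i * j → p * p ∣ j
  p*p∣⇒p*p∣ {p} i j p-prime p∤i p²∣ij with euclidsLemma i j p-prime (m*n∣⇒m∣ p p p²∣ij)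
  ... | inj₁ p∣i = contradiction p∣i p∤i
  ... | inj₂ (divides k refl) with euclidsLemma i k p-prime
          (*-cancelʳ-∣ p {{prime⇒nonZero p-prime}} (subst (p * p ∣_) (sym (*-assoc i k p)) p²∣ij))
  ...   | inj₁ p∣i = contradiction p∣i p∤i
  ...   | inj₂ p∣k = *-monoˡ-∣ p p∣k

  p*p∣i*j⇒ : ∀ {p} i j → Prime p → p * p ∣ i * j → (p * p ∣ i ⊎ p * p ∣ j) ⊎ (p ∣ i × p ∣ j)
  p*p∣i*j⇒ {p} i j p-prime p²∣ij with p ∣? i | p ∣? j
  ... | yes p∣i | yes p∣j = inj₂ (p∣i , p∣j)
  ... | no p∤i  | _       = inj₁ (inj₂ (p*p∣⇒p*p∣ i j p-prime p∤i p²∣ij))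
  ... | yes _   | no p∤j  =
    inj₁ (inj₁ (p*p∣⇒p*p∣ j i p-prime p∤j (subst (p * p ∣_) (*-comm i j) p²∣ij)))

  T-≡-does : ∀ {A : Set} {b} (a? : Dec A) → b ≡ does a? → T b ⇔ A
  T-≡-does (yes a) refl = mk⇔ (λ _ → a) (λ _ → tt)
  T-≡-does (no ¬a) refl = mk⇔ (λ ()) ¬a

  T-not : ∀ {b} → T (not b) ⇔ (¬ T b)
  T-not {true}  = mk⇔ (λ ()) (λ ¬t → ¬t tt)
  T-not {false} = mk⇔ (λ _ ()) (λ _ → tt)

  -- The impossible combination of divisibility by p² but not by p is treated as if p divided too;
  -- only `p∣-classify` has to exclude it.
  classify : (p̂ p̂² q̂ : Bool) → Class
  classify _     true  true  = [0]
  classify _     true  false = [p²]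
  classify true  false true  = [pq]
  classify true  false false = [p]
  classify false false true  = [q]
  classify false false false = [1]

  q∣-classify : ∀ x y z → q∣ (classify x y z) ≡ z
  q∣-classify _     true  true  = refl
  q∣-classify _     true  false = refl
  q∣-classify true  false true  = refl
  q∣-classify true  false false = refl
  q∣-classify false false true  = refl
  q∣-classify false false false = refl

  p²∣-classify : ∀ x y z → p²∣ (classify x y z) ≡ y
  p²∣-classify _     true  true  = refl
  p²∣-classify _     true  false = refl
  p²∣-classify true  false true  = refl
  p²∣-classify true  false false = refl
  p²∣-classify false false true  = refl
  p²∣-classify false false false = refl

  p∣-classify : ∀ x y z → (T y → T x) → p∣ (classify x y z) ≡ x
  p∣-classify true  true  true  _   = refl
  p∣-classify true  true  false _   = refl
  p∣-classify false true  _     y⇒x = contradiction (y⇒x tt) λ ()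
  p∣-classify true  false true  _   = refl
  p∣-classify true  false false _   = refl
  p∣-classify false false true  _   = refl
  p∣-classify false false false _   = refl

  vertex-class : ∀ {x} → ¬ (T (p²∣ x) × T (q∣ x)) → (¬ T (p∣ x) → T (q∣ x)) → T (allows vertices x)
  vertex-class {[1]}  _  h = h λ ()
  vertex-class {[p]}  _  _ = tt
  vertex-class {[p²]} _  _ = tt
  vertex-class {[q]}  _  _ = tt
  vertex-class {[pq]} _  _ = tt
  vertex-class {[0]}  ¬0 _ = ¬0 (tt , tt)

  vertex-class⁻¹ : ∀ x → T (allows vertices x) → (T (p∣ x) ⊎ T (q∣ x)) × ¬ (T (p²∣ x) × T (q∣ x))
  vertex-class⁻¹ [p]  _ = inj₁ tt , λ ()
  vertex-class⁻¹ [p²] _ = inj₁ tt , λ ()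
  vertex-class⁻¹ [q]  _ = inj₂ tt , λ ()
  vertex-class⁻¹ [pq] _ = inj₁ tt , λ ()

  -- Summed over all residues, this decomposition and the four after it turn counts of multiples
  -- into linear equations for the class sizes.
  p∣-δ : ∀ x → bit (p∣ x) ≡ δ [p] x + δ [p²] x + δ [pq] x + δ [0] x
  p∣-δ [1]  = refl
  p∣-δ [p]  = refl
  p∣-δ [p²] = refl
  p∣-δ [q]  = refl
  p∣-δ [pq] = refl
  p∣-δ [0]  = refl

  p²∣-δ : ∀ x → bit (p²∣ x) ≡ δ [p²] x + δ [0] x
  p²∣-δ [1]  = refl
  p²∣-δ [p]  = refl
  p²∣-δ [p²] = refl
  p²∣-δ [q]  = refl
  p²∣-δ [pq] = refl
  p²∣-δ [0]  = refl

  q∣-δ : ∀ x → bit (q∣ x) ≡ δ [q] x + δ [pq] x + δ [0] x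
  q∣-δ [1]  = refl
  q∣-δ [p]  = refl
  q∣-δ [p²] = refl
  q∣-δ [q]  = refl
  q∣-δ [pq] = refl
  q∣-δ [0]  = refl

  pq∣-δ : ∀ x → bit (p∣ x ∧ q∣ x) ≡ δ [pq] x + δ [0] x
  pq∣-δ [1]  = refl
  pq∣-δ [p]  = refl
  pq∣-δ [p²] = refl
  pq∣-δ [q]  = refl
  pq∣-δ [pq] = refl
  pq∣-δ [0]  = refl

  p²q∣-δ : ∀ x → bit (p²∣ x ∧ q∣ x) ≡ δ [0] x
  p²q∣-δ [1]  = refl
  p²q∣-δ [p]  = refl
  p²q∣-δ [p²] = refl
  p²q∣-δ [q]  = refl
  p²q∣-δ [pq] = refl
  p²q∣-δ [0]  = refl

  -- Vertices, adjacency and class sizes in the ring of integers modulo p²q.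

  module Residues {p q : ℕ} (p-prime : Prime p) (q-prime : Prime q) (p<q : p < q)
                  .{{N≢0 : NonZero (p ^ 2 * q)}} where

    open Equivalence

    N : ℕ
    N = p ^ 2 * q

    open IntegersMod N

    private
      instance
        p≢0 : NonZero p
        p≢0 = prime⇒nonZero p-prime
        q≢0 : NonZero q
        q≢0 = prime⇒nonZero q-prime
        pp≢0 : NonZero (p * p)
        pp≢0 = m*n≢0 p p
        pq≢0 : NonZero (p * q)
        pq≢0 = m*n≢0 p q

    N≡p*p*q : N ≡ p * p * q
    N≡p*p*q = cong (λ z → p * z * q) (*-identityʳ p)

    q∤p : ¬ q ∣ p
    q∤p = >⇒∤ p<q

    q∤p*p : ¬ q ∣ p * p
    q∤p*p q∣pp = [ q∤p , q∤p ]′ (euclidsLemma p p q-prime q∣pp)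

    N∣ : ∀ {i} → p * p ∣ i → q ∣ i → N ∣ i
    N∣ {i} pp∣i q∣i = subst (_∣ i) (sym N≡p*p*q) (∣-*-prime q-prime q∤p*p pp∣i q∣i)

    pp∣N : p * p ∣ N
    pp∣N = subst (p * p ∣_) (sym N≡p*p*q) (m∣m*n q)

    q∣N : q ∣ N
    q∣N = n∣m*n (p ^ 2)

    classOf : ℕ → Class
    classOf i = classify (does (p ∣? i)) (does (p * p ∣? i)) (does (q ∣? i))

    p∣-classOf : ∀ i → p∣ (classOf i) ≡ does (p ∣? i)
    p∣-classOf i = p∣-classify _ (does (p * p ∣? i)) _ λ pp∣i →
      from (T-≡-does (p ∣? i) refl) (m*n∣⇒m∣ p p (to (T-≡-does (p * p ∣? i) refl) pp∣i))

    p²∣-classOf : ∀ i → p²∣ (classOf i) ≡ does (p * p ∣? i)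
    p²∣-classOf i = p²∣-classify (does (p ∣? i)) _ _

    q∣-classOf : ∀ i → q∣ (classOf i) ≡ does (q ∣? i)
    q∣-classOf i = q∣-classify (does (p ∣? i)) (does (p * p ∣? i)) _

    T-p∣ : ∀ i → T (p∣ (classOf i)) ⇔ p ∣ i
    T-p∣ i = T-≡-does (p ∣? i) (p∣-classOf i)

    T-p²∣ : ∀ i → T (p²∣ (classOf i)) ⇔ p * p ∣ i
    T-p²∣ i = T-≡-does (p * p ∣? i) (p²∣-classOf i)

    T-q∣ : ∀ i → T (q∣ (classOf i)) ⇔ q ∣ i
    T-q∣ i = T-≡-does (q ∣? i) (q∣-classOf i)

    N∣* : ∀ i j → (q ∣ i ⊎ q ∣ j) → ((p * p ∣ i ⊎ p * p ∣ j) ⊎ (p ∣ i × p ∣ j)) → N ∣ i * j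
    N∣* i j q∣ pp∣ = N∣ ([ [ ∣m⇒∣m*n j , ∣n⇒∣m*n i ]′ , (λ (p∣i , p∣j) → *-pres-∣ p∣i p∣j) ]′ pp∣)
                        ([ ∣m⇒∣m*n j , ∣n⇒∣m*n i ]′ q∣)

    T-product≢0 : ∀ i j → T (product≢0 (classOf i) (classOf j)) ⇔ (¬ N ∣ i * j)
    T-product≢0 i j = mk⇔
      (λ t N∣ij → to T-not t (from T-∧
        ( from T-∨ (Sum.map (from (T-q∣ i)) (from (T-q∣ j))
            (euclidsLemma i j q-prime (∣-trans q∣N N∣ij)))
        , from T-∨ (Sum.map (from T-∨ ∘ Sum.map (from (T-p²∣ i)) (from (T-p²∣ j)))
                            (λ (p∣i , p∣j) → from T-∧ (from (T-p∣ i) p∣i , from (T-p∣ j) p∣j))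
            (p*p∣i*j⇒ i j p-prime (∣-trans pp∣N N∣ij))))))
      (λ N∤ij → from T-not λ t → N∤ij (let t-q , t-p = to T-∧ t in N∣* i j
        (Sum.map (to (T-q∣ i)) (to (T-q∣ j)) (to T-∨ t-q))
        (Sum.map (Sum.map (to (T-p²∣ i)) (to (T-p²∣ j)) ∘ to T-∨)
                 (λ t → let t-i , t-j = to T-∧ t in to (T-p∣ i) t-i , to (T-p∣ j) t-j)
                 (to T-∨ t-p))))

    toℕ-mod : ∀ i → toℕ (i mod N) ≡ i % N
    toℕ-mod i = Fin.toℕ-fromℕ< _

    toℕ-0ₙ : toℕ 0ₙ ≡ 0
    toℕ-0ₙ = trans (toℕ-mod 0) (m<n⇒m%n≡m (>-nonZero⁻¹ N))

    *ₙ≡0⇔ : ∀ a b → a *ₙ b ≡ 0ₙ ⇔ N ∣ toℕ a * toℕ b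
    *ₙ≡0⇔ a b = mk⇔
      (λ ab≡0 → m%n≡0⇒n∣m (toℕ a * toℕ b) N
        (trans (sym (toℕ-mod (toℕ a * toℕ b))) (trans (cong toℕ ab≡0) toℕ-0ₙ)))
      (λ N∣ab → Fin.toℕ-injective
        (trans (toℕ-mod (toℕ a * toℕ b)) (trans (n∣m⇒m%n≡0 (toℕ a * toℕ b) N N∣ab) (sym toℕ-0ₙ))))

    N∣⇒≡0ₙ : ∀ (a : ℤₙ) → N ∣ toℕ a → a ≡ 0ₙ
    N∣⇒≡0ₙ a N∣a with toℕ a in eq
    ... | zero  = Fin.toℕ-injective (trans eq (sym toℕ-0ₙ))
    ... | suc k = contradiction (subst (N ≤_) (sym eq) (∣⇒≤ N∣a)) (<⇒≱ (Fin.toℕ<n a))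

    residue≢0 : ∀ {i} (i<N : i < N) → 0 < i → fromℕ< i<N ≢ 0ₙ
    residue≢0 i<N 0<i i≡0 =
      <⇒≢ 0<i (sym (trans (sym (Fin.toℕ-fromℕ< i<N)) (trans (cong toℕ i≡0) toℕ-0ₙ)))

    witness : ∀ (a : ℤₙ) i → i < N → 0 < i → N ∣ toℕ a * i → a ≢ 0ₙ → NonZeroZeroDivisor a
    witness a i i<N 0<i N∣ai a≢0 = a≢0 , fromℕ< i<N , residue≢0 i<N 0<i ,
      from (*ₙ≡0⇔ a (fromℕ< i<N)) (subst (λ z → N ∣ toℕ a * z) (sym (Fin.toℕ-fromℕ< i<N)) N∣ai)

    -- If `p` does not divide `a`, an annihilator `b` is divisible by p²; were it also divisible by
    -- `q`, it would be zero, so `q` divides `a`. Conversely `p * q` annihilates the multiples of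
    -- `p`, and `p * p` those of `q`; both lie strictly between 0 and `N`.
    classOf-vertex : ∀ a → NonZeroZeroDivisor a ⇔ T (allows vertices (classOf (toℕ a)))
    classOf-vertex a = mk⇔ ⇒ ⇐
      where
      i = toℕ a
      ⇒ : NonZeroZeroDivisor a → T (allows vertices (classOf i))
      ⇒ (a≢0 , b , b≢0 , ab≡0) = vertex-class
        (λ (t-p² , t-q) → a≢0 (N∣⇒≡0ₙ a (N∣ (to (T-p²∣ i) t-p²) (to (T-q∣ i) t-q))))
        (λ ¬t-p → from (T-q∣ i) (q∣i (¬t-p ∘ from (T-p∣ i))))
        where
        N∣ij : N ∣ i * toℕ b
        N∣ij = to (*ₙ≡0⇔ a b) ab≡0
        q∣i : ¬ p ∣ i → q ∣ i
        q∣i p∤i with euclidsLemma i (toℕ b) q-prime (∣-trans q∣N N∣ij)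
        ... | inj₁ q∣i = q∣i
        ... | inj₂ q∣j = contradiction
          (N∣⇒≡0ₙ b (N∣ (p*p∣⇒p*p∣ i (toℕ b) p-prime p∤i (∣-trans pp∣N N∣ij)) q∣j)) b≢0
      ⇐ : T (allows vertices (classOf i)) → NonZeroZeroDivisor a
      ⇐ t with vertex-class⁻¹ (classOf i) t
      ... | divisible , ¬0 = [ (λ t-p → p-witness (to (T-p∣ i) t-p))
                             , (λ t-q → q-witness (to (T-q∣ i) t-q)) ]′ divisible
        where
        a≢0 : a ≢ 0ₙ
        a≢0 refl = ¬0 ( from (T-p²∣ i) (subst (p * p ∣_) (sym toℕ-0ₙ) ((p * p) ∣0))
                      , from (T-q∣ i) (subst (q ∣_) (sym toℕ-0ₙ) (q ∣0)))
        N≡p*[p*q] : N ≡ p * (p * q)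
        N≡p*[p*q] = trans N≡p*p*q (*-assoc p p q)
        p-witness : p ∣ i → NonZeroZeroDivisor a
        p-witness p∣i = witness a (p * q)
          (subst (p * q <_) (trans (*-comm (p * q) p) (sym N≡p*[p*q]))
            (m<m*n (p * q) p (nonTrivial⇒n>1 p {{prime⇒nonTrivial p-prime}})))
          (>-nonZero⁻¹ (p * q))
          (subst (_∣ i * (p * q)) (sym N≡p*[p*q]) (*-pres-∣ p∣i ∣-refl)) a≢0
        q-witness : q ∣ i → NonZeroZeroDivisor a
        q-witness q∣i = witness a (p * p)
          (subst (p * p <_) (sym N≡p*p*q)
            (m<m*n (p * p) q (nonTrivial⇒n>1 q {{prime⇒nonTrivial q-prime}})))
          (>-nonZero⁻¹ (p * p))
          (N∣* i (p * p) (inj₁ q∣i) (inj₁ (inj₂ ∣-refl))) a≢0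

    classOf-independent : ∀ {S} → Independent (zeroDivisorGraph N) S ⇔ IndependentIn vertices (classOf ∘ toℕ) S
    classOf-independent = mk⇔
      (λ (vertex , nonAdjacent) →
          (λ a a∈S → to (classOf-vertex a) (vertex a a∈S))
        , (λ a b a∈S b∈S a≢b → from (T-product≢0 (toℕ a) (toℕ b)) λ N∣ab →
             nonAdjacent a b a∈S b∈S (a≢b , from (*ₙ≡0⇔ a b) N∣ab)))
      (λ (allowed , nonzero) →
          (λ a a∈S → from (classOf-vertex a) (allowed a a∈S))
        , (λ a b a∈S b∈S (a≢b , ab≡0) →
             to (T-product≢0 (toℕ a) (toℕ b)) (nonzero a b a∈S b∈S a≢b) (to (*ₙ≡0⇔ a b) ab≡0)))

    #_ : Class → ℕ
    # x = #[ x ] {N} (classOf ∘ toℕ)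

    sum-bit : ∀ (φ : Class → Bool) d .{{_ : NonZero d}} e → N ≡ e * d →
              (∀ i → φ (classOf i) ≡ does (d ∣? i)) → sum {N} (bit ∘ φ ∘ classOf ∘ toℕ) ≡ e
    sum-bit φ d e N≡ed φ≡ = trans (sum-cong-≗ {N} λ i → cong bit (φ≡ (toℕ i)))
      (subst (λ n → sum {n} (λ i → bit (does (d ∣? toℕ i))) ≡ e) (sym N≡ed) (#multiples d e))

    sum-+ : ∀ (v w : Class → ℕ) → sum {N} (λ i → v (classOf (toℕ i)) + w (classOf (toℕ i)))
                                ≡ sum {N} (v ∘ classOf ∘ toℕ) + sum {N} (w ∘ classOf ∘ toℕ)
    sum-+ v w = ∑-distrib-+ {N} (v ∘ classOf ∘ toℕ) (w ∘ classOf ∘ toℕ)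

    #multiples-N : # [0] ≡ 1
    #multiples-N = trans (sum-cong-≗ {N} λ i → sym (p²q∣-δ (classOf (toℕ i))))
      (sum-bit (λ x → p²∣ x ∧ q∣ x) N 1 (sym (*-identityˡ N)) λ i →
        trans (cong₂ _∧_ (p²∣-classOf i) (q∣-classOf i))
              (does-⇔ (mk⇔ (λ (pp∣i , q∣i) → N∣ pp∣i q∣i)
                           (λ N∣i → ∣-trans pp∣N N∣i , ∣-trans q∣N N∣i))
                      ((p * p ∣? i) ×-dec (q ∣? i)) (N ∣? i)))

    #multiples-pq : # [pq] + # [0] ≡ p
    #multiples-pq = trans (sym (sum-+ (δ [pq]) (δ [0])))
      (trans (sum-cong-≗ {N} λ i → sym (pq∣-δ (classOf (toℕ i))))
      (sum-bit (λ x → p∣ x ∧ q∣ x) (p * q) p (trans N≡p*p*q (*-assoc p p q)) λ i →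
        trans (cong₂ _∧_ (p∣-classOf i) (q∣-classOf i))
              (does-⇔ (mk⇔ (λ (p∣i , q∣i) → ∣-*-prime q-prime q∤p p∣i q∣i)
                           (λ pq∣i → m*n∣⇒m∣ p q pq∣i , m*n∣⇒n∣ p q pq∣i))
                      ((p ∣? i) ×-dec (q ∣? i)) (p * q ∣? i))))

    #multiples-p² : # [p²] + # [0] ≡ q
    #multiples-p² = trans (sym (sum-+ (δ [p²]) (δ [0])))
      (trans (sum-cong-≗ {N} λ i → sym (p²∣-δ (classOf (toℕ i))))
      (sum-bit p²∣ (p * p) q (trans N≡p*p*q (*-comm (p * p) q)) p²∣-classOf))

    #multiples-q : # [q] + # [pq] + # [0] ≡ p * p
    #multiples-q = trans (cong (_+ # [0]) (sym (sum-+ (δ [q]) (δ [pq]))))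
      (trans (sym (sum-+ (λ x → δ [q] x + δ [pq] x) (δ [0])))
      (trans (sum-cong-≗ {N} λ i → sym (q∣-δ (classOf (toℕ i))))
      (sum-bit q∣ q (p * p) N≡p*p*q q∣-classOf)))

    #multiples-p : # [p] + # [p²] + # [pq] + # [0] ≡ p * q
    #multiples-p = trans (cong (λ z → z + # [pq] + # [0]) (sym (sum-+ (δ [p]) (δ [p²]))))
      (trans (cong (_+ # [0]) (sym (sum-+ (λ x → δ [p] x + δ [p²] x) (δ [pq]))))
      (trans (sym (sum-+ (λ x → δ [p] x + δ [p²] x + δ [pq] x) (δ [0])))
      (trans (sum-cong-≗ {N} λ i → sym (p∣-δ (classOf (toℕ i))))
      (sum-bit p∣ p (p * q) N≡[p*q]*p p∣-classOf))))
      where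
      N≡[p*q]*p : N ≡ p * q * p
      N≡[p*q]*p = trans N≡p*p*q (trans (*-assoc p p q) (*-comm p (p * q)))

  -- The system is triangular: the multiples of pq and of p² give `npq` and `np²`, then
  -- `nq = p² - p`, and `np = p q - (q - 1) - (p - 1) - 1` factors as `(p - 1) (q - 1)`.
  class-sizes : ∀ p q .{{_ : NonZero p}} .{{_ : NonZero q}} {np np² nq npq n0} →
    n0 ≡ 1 → npq + n0 ≡ p → np² + n0 ≡ q → nq + npq + n0 ≡ p * p → np + np² + npq + n0 ≡ p * q →
    np ≡ (p ∸ 1) * (q ∸ 1) × np² ≡ q ∸ 1 × nq ≡ p * (p ∸ 1) × npq ≡ p ∸ 1
  class-sizes (suc d) (suc b) {np} {np²} {nq} {npq} refl eq-pq eq-p² eq-q eq-p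
    with refl ← suc-injective (trans (sym (+-comm npq 1)) eq-pq)
       | refl ← suc-injective (trans (sym (+-comm np² 1)) eq-p²) =
      +-cancelʳ-≡ (b + d + 1) np (d * b) (trans (assoc np b d) (trans eq-p (expand d b)))
    , refl
    , +-cancelʳ-≡ (d + 1) nq (suc d * d) (trans (sym (+-assoc nq d 1)) (trans eq-q (expand′ d)))
    , refl
    where
    assoc : ∀ n b d → n + (b + d + 1) ≡ n + b + d + 1
    assoc = solve-∀
    expand : ∀ d b → suc d * suc b ≡ d * b + (b + d + 1)
    expand = solve-∀
    expand′ : ∀ d → suc d * suc d ≡ suc d * d + (d + 1)
    expand′ = solve-∀

open ZeroDivisors
open RatiosDecrease

open import Data.Fin.Subset using (∣_∣)
open import Data.Integer as ℤ using (ℤ; +_)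
import Data.Integer.Properties as ℤ
open import Data.List.Extrema.Nat using (argmax-sel; xs≤max)
open import Data.List.Membership.Propositional using (lose)
open import Data.List.Membership.Propositional.Properties using (∈-map⁻)
import Data.List.Relation.Unary.All.Properties as All
open import Data.Nat as ℕ
  using (ℕ; zero; suc; z≤n; s≤s; z<s; _<_; _≤_; _∸_; NonZero; >-nonZero; _<?_; _≤?_)
open import Data.Nat.Properties as ℕ
open import Defs

-- Coefficients of integer polynomials.

coeff-applyUpTo-< : ∀ f n {k} → k < n → coeff (applyUpTo f n) k ≡ f k
coeff-applyUpTo-< f (suc n) {zero}  _         = refl
coeff-applyUpTo-< f (suc n) {suc k} (s≤s k<n) = coeff-applyUpTo-< (f ∘ suc) n k<n

coeff-applyUpTo-≥ : ∀ f n {k} → n ≤ k → coeff (applyUpTo f n) k ≡ + 0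
coeff-applyUpTo-≥ f zero            _         = refl
coeff-applyUpTo-≥ f (suc n) {suc k} (s≤s n≤k) = coeff-applyUpTo-≥ (f ∘ suc) n n≤k

coeff-+ : ∀ f g k → coeff (f + g) k ≡ coeff f k ℤ.+ coeff g k
coeff-+ []      g       k       = sym (ℤ.+-identityˡ (coeff g k))
coeff-+ (a ∷ f) []      k       = sym (ℤ.+-identityʳ (coeff (a ∷ f) k))
coeff-+ (a ∷ f) (b ∷ g) zero    = refl
coeff-+ (a ∷ f) (b ∷ g) (suc k) = coeff-+ f g k

coeff-map : ∀ (φ : ℤ → ℤ) f k → φ (+ 0) ≡ + 0 → coeff (map φ f) k ≡ φ (coeff f k)
coeff-map φ []      k       φ0≡0 = sym φ0≡0
coeff-map φ (a ∷ f) zero    φ0≡0 = refl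
coeff-map φ (a ∷ f) (suc k) φ0≡0 = coeff-map φ f k φ0≡0

coeff-minus : ∀ f g k → coeff (f - g) k ≡ coeff f k ℤ.- coeff g k
coeff-minus f g k = trans (coeff-+ f (map ℤ.-_ g) k) (cong (λ z → coeff f k ℤ.+ z) (coeff-map ℤ.-_ g k refl))

coeff-0∷[] : ∀ k → coeff (+ 0 ∷ []) k ≡ + 0
coeff-0∷[] zero    = refl
coeff-0∷[] (suc k) = refl

coeff-linear-zero : ∀ u v f → coeff ((u ∷ v ∷ []) * f) 0 ≡ u ℤ.* coeff f 0
coeff-linear-zero u v f = trans (coeff-+ (map (u ℤ.*_) f) _ 0)
  (trans (ℤ.+-identityʳ _) (coeff-map (u ℤ.*_) f 0 (ℤ.*-zeroʳ u)))

coeff-linear-suc : ∀ u v f k → coeff ((u ∷ v ∷ []) * f) (suc k) ≡ u ℤ.* coeff f (suc k) ℤ.+ v ℤ.* coeff f k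
coeff-linear-suc u v f k = trans (coeff-+ (map (u ℤ.*_) f) (+ 0 ∷ (v ∷ []) * f) (suc k))
  (cong₂ ℤ._+_ (coeff-map (u ℤ.*_) f (suc k) (ℤ.*-zeroʳ u))
    (trans (coeff-+ (map (v ℤ.*_) f) (+ 0 ∷ []) k)
      (trans (cong (λ z → coeff (map (v ℤ.*_) f) k ℤ.+ z) (coeff-0∷[] k))
        (trans (ℤ.+-identityʳ _) (coeff-map (v ℤ.*_) f k (ℤ.*-zeroʳ v))))))

coeff-1+X^ : ∀ n k → coeff ((const (+ 1) + X) ^ n) k ≡ + (n C k)
coeff-1+X^ zero    zero    = refl
coeff-1+X^ zero    (suc k) = refl
coeff-1+X^ (suc n) zero    = trans (coeff-linear-zero (+ 1) (+ 1) ((const (+ 1) + X) ^ n))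
  (cong (ℤ._*_ (+ 1)) (coeff-1+X^ n 0))
coeff-1+X^ (suc n) (suc k) = trans (coeff-linear-suc (+ 1) (+ 1) ((const (+ 1) + X) ^ n) k)
  (trans (cong₂ ℤ._+_ (1*coeff (suc k)) (1*coeff k)) (cong +_ (sym (pascal n (suc k)))))
  where
  1*coeff : ∀ k → + 1 ℤ.* coeff ((const (+ 1) + X) ^ n) k ≡ + (n C k)
  1*coeff k = trans (ℤ.*-identityˡ _) (coeff-1+X^ n k)

-- An equality of lists and not merely of coefficients, so that it can be substituted inside a
-- further product.
const*X : ∀ a → const a * X ≡ + 0 ∷ a ∷ []
const*X a = cong₂ (λ y z → y ℤ.+ + 0 ∷ z ∷ []) (ℤ.*-zeroʳ a) (ℤ.*-identityʳ a)

coeff-dX*1+X^ : ∀ d n k → coeff (const (+ d) * X * (const (+ 1) + X) ^ n) k ≡ + (d ℕ.* shift (n C_) k)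
coeff-dX*1+X^ d n k = trans (cong (λ f → coeff (f * (const (+ 1) + X) ^ n) k) (const*X (+ d))) (expand k)
  where
  expand : ∀ k → coeff ((+ 0 ∷ + d ∷ []) * (const (+ 1) + X) ^ n) k ≡ + (d ℕ.* shift (n C_) k)
  expand zero    = trans (coeff-linear-zero (+ 0) (+ d) ((const (+ 1) + X) ^ n))
    (cong +_ (sym (ℕ.*-zeroʳ d)))
  expand (suc k) = trans (coeff-linear-suc (+ 0) (+ d) ((const (+ 1) + X) ^ n) k)
    (trans (ℤ.+-identityˡ _)
      (trans (cong (ℤ._*_ (+ d)) (coeff-1+X^ n k)) (sym (ℤ.pos-* d (n C k)))))

-- Unimodality from decreasing ratios.

first-nonincrease : ∀ (f : Seq) n →
  (∀ i → i < n → f i < f (suc i)) ⊎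
  (∃[ m ] (m < n × f (suc m) ≤ f m × (∀ i → i < m → f i < f (suc i))))
first-nonincrease f zero = inj₁ λ _ ()
first-nonincrease f (suc n) with first-nonincrease f n
... | inj₂ (m , m<n , descent , below) = inj₂ (m , m<n⇒m<1+n m<n , descent , below)
... | inj₁ below with f n <? f (suc n)
...   | no fn≮  = inj₂ (n , n<1+n n , ≮⇒≥ fn≮ , below)
...   | yes fn< = inj₁ λ i i<1+n → increase i (m<1+n⇒m<n∨m≡n i<1+n)
  where
  increase : ∀ i → i < n ⊎ i ≡ n → f i < f (suc i)
  increase i (inj₁ i<n)  = below i i<n
  increase i (inj₂ refl) = fn<

-- The peak is the first place without strict increase. From there on the ratios stay at most 1; the
-- argument cancels `f m`, which is positive because it is the head or exceeds its predecessor.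
ratiosDecrease⇒unimodal : ∀ {f} → RatiosDecrease f → 0 < f 0 → ∀ n → ∃[ m ] (m ≤ n ×
  (∀ i → i < m → f i ≤ f (suc i)) × (∀ i → m ≤ i → i < n → f (suc i) ≤ f i))
ratiosDecrease⇒unimodal {f} rd 0<f0 n with first-nonincrease f n
... | inj₁ below = n , ≤-refl , (λ i i<n → <⇒≤ (below i i<n)) ,
                   (λ i n≤i i<n → contradiction i<n (≤⇒≯ n≤i))
... | inj₂ (m , m<n , descent , below) =
  m , <⇒≤ m<n , (λ i i<m → <⇒≤ (below i i<m)) , λ i m≤i _ → *-cancelˡ-≤ (f m) {{fm≢0}}
    (≤-trans (ratio rd m i m≤i) (*-monoˡ-≤ (f i) descent))
  where
  positive : ∀ m → (∀ i → i < m → f i < f (suc i)) → 0 < f m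
  positive zero    _     = 0<f0
  positive (suc m) below = ≤-<-trans z≤n (below m (n<1+n m))
  fm≢0 : NonZero (f m)
  fm≢0 = >-nonZero (positive m below)

-- Degree and coefficients of an independence polynomial.

module _ {m : ℕ} (G : SimpleGraph m) where

  s>α : ∀ {k} → α G < k → s G k ≡ 0
  s>α {k} α<k = cong length (filter-none (λ S → ∣ S ∣ ℕ.≟ k)
    (All.map (λ { ∣S∣≤α refl → contradiction α<k (≤⇒≯ ∣S∣≤α) })
      (All.map⁻ (xs≤max 0 (map ∣_∣ (independentSets G))))))

  s-α : 0 < s G 0 → 0 < s G (α G)
  s-α 0<s₀ with argmax-sel id 0 (map ∣_∣ (independentSets G))
  -- The maximum may be the default 0 instead of the size of a listed set; this case rests on the
  -- hypothesis about `s G 0`.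
  ... | inj₁ α≡0 = subst (λ k → 0 < s G k) (sym α≡0) 0<s₀
  ... | inj₂ α∈ with S , S∈ , α≡∣S∣ ← ∈-map⁻ ∣_∣ α∈ =
    filter-some (λ S → ∣ S ∣ ℕ.≟ α G) (lose S∈ (sym α≡∣S∣))

  coeff-independencePolynomial : ∀ k → coeff (independencePolynomial G) k ≡ + s G k
  coeff-independencePolynomial k
    rewrite map-upTo (λ k → + s G k) (suc (α G)) with k ≤? α G
  ... | yes k≤α = coeff-applyUpTo-< (λ k → + s G k) (suc (α G)) (s≤s k≤α)
  ... | no k≰α  = trans (coeff-applyUpTo-≥ (λ k → + s G k) (suc (α G)) (≰⇒> k≰α))
                        (cong +_ (sym (s>α (≰⇒> k≰α))))

  private
    c≡s = coeff-independencePolynomial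

    ≤-coeff : ∀ i j → s G i ≤ s G j →
              coeff (independencePolynomial G) i ℤ.≤ coeff (independencePolynomial G) j
    ≤-coeff i j si≤sj rewrite c≡s i | c≡s j = ℤ.+≤+ si≤sj

  hasDegree-α : 0 < s G 0 → HasDegree (independencePolynomial G) (α G)
  hasDegree-α 0<s₀ =
      (λ c≡0 → <⇒≢ (s-α 0<s₀) (sym (ℤ.+-injective (trans (sym (c≡s (α G))) c≡0))))
    , (λ k α<k → trans (c≡s k) (cong +_ (s>α α<k)))

  ratiosDecrease⇒LogConcave : 0 < s G 0 → RatiosDecrease (s G) → LogConcave (independencePolynomial G)
  ratiosDecrease⇒LogConcave 0<s₀ rd = α G , hasDegree-α 0<s₀ , λ j _ → ineq j
    where
    ineq : ∀ j → let c = coeff (independencePolynomial G) in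
           c j ℤ.* c (suc (suc j)) ℤ.≤ c (suc j) ℤ.* c (suc j)
    ineq j rewrite c≡s j | c≡s (suc j) | c≡s (suc (suc j))
                 | sym (ℤ.pos-* (s G j) (s G (suc (suc j))))
                 | sym (ℤ.pos-* (s G (suc j)) (s G (suc j))) = ℤ.+≤+ (ratio rd j (suc j) (n≤1+n j))

  ratiosDecrease⇒Unimodal : 0 < s G 0 → RatiosDecrease (s G) → Unimodal (independencePolynomial G)
  ratiosDecrease⇒Unimodal 0<s₀ rd with n , n≤α , up , down ← ratiosDecrease⇒unimodal rd 0<s₀ (α G) =
    α G , hasDegree-α 0<s₀ , n , n≤α , (λ i i<n → ≤-coeff i (suc i) (up i i<n)) ,
    (λ i n≤i i<α → ≤-coeff (suc i) i (down i n≤i i<α))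

-- The zero divisor graph: explicit formula, log-concavity and unimodality.

independenceCounts-zeroDivisorGraph : ∀ p q .{{_ : NonZero (p ℕ.^ 2 ℕ.* q)}} →
  Prime p → Prime q → p < q →
  IndependenceCounts (s (zeroDivisorGraph (p ℕ.^ 2 ℕ.* q)))
                     ((p ∸ 1) ℕ.* (q ∸ 1)) (q ∸ 1) (p ℕ.* (p ∸ 1)) (p ∸ 1)
independenceCounts-zeroDivisorGraph p q p-prime q-prime p<q k =
  trans (cong (ℕ._+ ((p ∸ 1) ℕ.* (q ∸ 1)) C k) s≡) (substitute
    (class-sizes p q {{prime⇒nonZero p-prime}} {{prime⇒nonZero q-prime}}
      #multiples-N #multiples-pq #multiples-p² #multiples-q #multiples-p)
    (#vertices cls k))
  where
  open Residues p-prime q-prime p<q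
  cls = classOf ∘ toℕ {N}
  s≡ : s (zeroDivisorGraph N) k ≡ #extensible vertices cls k
  s≡ = #sets-cong (independent? (zeroDivisorGraph N)) (λ S → T? (extensible vertices cls S))
    (independentIn⇒extensible vertices cls ∘ Equivalence.to classOf-independent)
    (Equivalence.from classOf-independent ∘ extensible⇒independentIn vertices cls) k
  substitute : ∀ {x a b′ c d′ a₀ b₀ c₀ d₀} → a ≡ a₀ × b′ ≡ b₀ × c ≡ c₀ × d′ ≡ d₀ →
    x ℕ.+ a C k ≡ (a ℕ.+ b′) C k ℕ.+ (a ℕ.+ c) C k ℕ.+ d′ ℕ.* shift (c C_) k →
    x ℕ.+ a₀ C k ≡ (a₀ ℕ.+ b₀) C k ℕ.+ (a₀ ℕ.+ c₀) C k ℕ.+ d₀ ℕ.* shift (c₀ C_) k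
  substitute (refl , refl , refl , refl) eq = eq

-- Here the subtraction reappears. The terms `u` and `v` trade places because the stated formula
-- begins with the exponent `(p - 1) (p + q - 1)`, which is `a + c`, and continues with `p (q - 1)`,
-- which is `a + b`.
move-to-right : ∀ {s a u v w} → s ℕ.+ a ≡ u ℕ.+ v ℕ.+ w → + s ≡ + v ℤ.+ + u ℤ.- + a ℤ.+ + w
move-to-right {s} {a} {u} {v} {w} eq = begin
  + s                               ≡⟨ ℤ.+-identityʳ (+ s) ⟨
  + s ℤ.+ + 0                       ≡⟨ cong (λ z → + s ℤ.+ z) (ℤ.+-inverseʳ (+ a)) ⟨
  + s ℤ.+ (+ a ℤ.- + a)             ≡⟨ ℤ.+-assoc (+ s) (+ a) (ℤ.- (+ a)) ⟨
  + (s ℕ.+ a) ℤ.- + a               ≡⟨ cong (λ z → + z ℤ.- + a) (trans eq (swap u v w)) ⟩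
  + (v ℕ.+ u) ℤ.+ + w ℤ.- + a       ≡⟨ ℤ.+-assoc (+ (v ℕ.+ u)) (+ w) (ℤ.- (+ a)) ⟩
  + (v ℕ.+ u) ℤ.+ (+ w ℤ.- + a)     ≡⟨ cong (λ z → + (v ℕ.+ u) ℤ.+ z) (ℤ.+-comm (+ w) (ℤ.- (+ a))) ⟩
  + (v ℕ.+ u) ℤ.+ (ℤ.- (+ a) ℤ.+ + w) ≡⟨ ℤ.+-assoc (+ (v ℕ.+ u)) (ℤ.- (+ a)) (+ w) ⟨
  + v ℤ.+ + u ℤ.- + a ℤ.+ + w       ∎
  where
  open ≡-Reasoning
  swap : ∀ u v w → u ℕ.+ v ℕ.+ w ≡ v ℕ.+ u ℕ.+ w
  swap = solve-∀

≈-formula : ∀ d b {I f} → (∀ k → coeff I k ≡ + f k) →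
  IndependenceCounts f (d ℕ.* b) b (suc d ℕ.* d) d →
  let 1+X = const (+ 1) + X in
  I ≈ 1+X ^ (d ℕ.* (d ℕ.+ suc b)) + 1+X ^ (suc d ℕ.* b) - 1+X ^ (d ℕ.* b)
      + const (+ d) * X * 1+X ^ (suc d ℕ.* d)
≈-formula d b {I} {f} coeff-I eq k = begin
  coeff I k
    ≡⟨ coeff-I k ⟩
  + f k
    ≡⟨ move-to-right {f k} {(d ℕ.* b) C k} {(d ℕ.* b ℕ.+ b) C k} {(d ℕ.* b ℕ.+ suc d ℕ.* d) C k} (eq k) ⟩
  + ((d ℕ.* b ℕ.+ suc d ℕ.* d) C k) ℤ.+ + ((d ℕ.* b ℕ.+ b) C k) ℤ.- + ((d ℕ.* b) C k) ℤ.+ + w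
    ≡⟨ cong₂ (λ y z → + (y C k) ℤ.+ + (z C k) ℤ.- + ((d ℕ.* b) C k) ℤ.+ + w)
             (exponents₁ d b) (exponents₂ d b) ⟩
  + ((d ℕ.* (d ℕ.+ suc b)) C k) ℤ.+ + ((suc d ℕ.* b) C k) ℤ.- + ((d ℕ.* b) C k) ℤ.+ + w
    ≡⟨ cong₂ ℤ._+_ (cong₂ ℤ._-_ (cong₂ ℤ._+_ (coeff-1+X^ (d ℕ.* (d ℕ.+ suc b)) k)
                                            (coeff-1+X^ (suc d ℕ.* b) k))
                               (coeff-1+X^ (d ℕ.* b) k))
                   (coeff-dX*1+X^ d (suc d ℕ.* d) k) ⟨
  coeff P k ℤ.+ coeff Q k ℤ.- coeff R k ℤ.+ coeff S k
    ≡⟨ cong (λ z → z ℤ.- coeff R k ℤ.+ coeff S k) (coeff-+ P Q k) ⟨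
  coeff (P + Q) k ℤ.- coeff R k ℤ.+ coeff S k
    ≡⟨ cong (λ z → z ℤ.+ coeff S k) (coeff-minus (P + Q) R k) ⟨
  coeff (P + Q - R) k ℤ.+ coeff S k
    ≡⟨ coeff-+ (P + Q - R) S k ⟨
  coeff (P + Q - R + S) k ∎
  where
  open ≡-Reasoning
  1+X P Q R S : Poly
  1+X = const (+ 1) + X
  P = 1+X ^ (d ℕ.* (d ℕ.+ suc b))
  Q = 1+X ^ (suc d ℕ.* b)
  R = 1+X ^ (d ℕ.* b)
  S = const (+ d) * X * 1+X ^ (suc d ℕ.* d)
  w : ℕ
  w = d ℕ.* shift ((suc d ℕ.* d) C_) k
  exponents₁ : ∀ d b → d ℕ.* b ℕ.+ suc d ℕ.* d ≡ d ℕ.* (d ℕ.+ suc b)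
  exponents₁ = solve-∀
  exponents₂ : ∀ d b → d ℕ.* b ℕ.+ b ≡ suc d ℕ.* b
  exponents₂ = solve-∀

-- Once `p` is `2 + D` and `q` is `1 + b`, all truncated subtractions compute and the exponents
-- become those of `≈-formula`.
fromIndependenceCounts : ∀ {m} (G : SimpleGraph m) p q → Prime p → p < q →
  let I = independencePolynomial G; 1+X = const (+ 1) + X in
  IndependenceCounts (s G) ((p ∸ 1) ℕ.* (q ∸ 1)) (q ∸ 1) (p ℕ.* (p ∸ 1)) (p ∸ 1) →
  (I ≈ 1+X ^ ((p ∸ 1) ℕ.* (p ℕ.+ q ∸ 1))
       + 1+X ^ (p ℕ.* (q ∸ 1))
       - 1+X ^ ((p ∸ 1) ℕ.* (q ∸ 1))
       + const (+ (p ∸ 1)) * X * 1+X ^ (p ℕ.* (p ∸ 1)))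
  × LogConcave I
  × Unimodal I
fromIndependenceCounts G zero          q       p-prime _         _      = contradiction p-prime ¬prime[0]
fromIndependenceCounts G (suc zero)    q       p-prime _         _      = contradiction p-prime ¬prime[1]
fromIndependenceCounts G (suc (suc D)) (suc b) _       (s≤s d<b) counts =
    ≈-formula (suc D) b {independencePolynomial G} {s G} (coeff-independencePolynomial G) counts
  , ratiosDecrease⇒LogConcave G 0<s₀ rd
  , ratiosDecrease⇒Unimodal G 0<s₀ rd
  where
  rd : RatiosDecrease (s G)
  rd = rd-IndependenceCounts D b d<b counts
  -- At `k = 0` the counting identity reads `s₀ + 1 = 1 + 1 + 0`, which yields the empty set without
  -- inspecting the graph.
  head-positive : ∀ {x} → x ℕ.+ 1 ≡ 2 ℕ.+ suc D ℕ.* 0 → 0 < x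
  head-positive {zero}  eq = contradiction eq λ ()
  head-positive {suc x} _  = z<s
  0<s₀ : 0 < s G 0
  0<s₀ = head-positive {s G 0} (counts 0)

theorem3p2 : (p q : ℕ) .{{_ : NonZero (p ℕ.^ 2 ℕ.* q)}} → Prime p → Prime q → p < q →
    let I = independencePolynomial (zeroDivisorGraph (p ℕ.^ 2 ℕ.* q))
        1+X = const (+ 1) + X
    in (I ≈ 1+X ^ ((p ∸ 1) ℕ.* (p ℕ.+ q ∸ 1))
            + 1+X ^ (p ℕ.* (q ∸ 1))
            - 1+X ^ ((p ∸ 1) ℕ.* (q ∸ 1))
            + const (+ (p ∸ 1)) * X * 1+X ^ (p ℕ.* (p ∸ 1)))
       × LogConcave I
       × Unimodal I
theorem3p2 p q p-prime q-prime p<q = fromIndependenceCounts (zeroDivisorGraph (p ℕ.^ 2 ℕ.* q)) p q p-prime p<q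
  (independenceCounts-zeroDivisorGraph p q p-prime q-prime p<q)
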